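{- Every stacked component $\mathcal{T}$ (the graph specified in the context) satisfies $\mathrm{diam}(\mathcal{T})=\frac12(\mathrm{ord}(\ell)+3)$.
   Context: Let $p$ be a prime with $p\equiv 71$ or $119\pmod{120}$, let $\ell=2$, and let $\mathrm{ord}(\ell)$ be the order, in the ideal class group of $\mathbb{Q}(\sqrt{ -p})$, of a prime ideal above $2$; it is an odd integer $\ge 3$. A stacked component $\mathcal{T}$ (a component of the supersingular $2$-isogeny graph over $\mathbb{F}_p$ after identifying curves up to $\overline{\mathbb{F}_p}$-isomorphism, regarded as a simple undirected graph) is, writing $L=\mathrm{ord}(\ell)$, labelled so that $V(\mathcal{T})=\{0,1,\dots,2L-1\}$ and $$E(\mathcal{T})=\{\{2i,2i+1\}:0\le i\le L-1\}\cup\{\{2i+1,2i+3\}:0\le i\le L-2\}\cup\{\{2L-1,1\}\}.$$ The diameter is the maximum graph distance between two vertices. -}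

module Defs where

open import Algebra.Bundles using (CommutativeRing)
open import Algebra.Structures using (IsCommutativeRing)
open import Data.Fin.Base using (Fin; toℕ)
open import Data.Integer.Base as ℤ using (ℤ; +_; 0ℤ; 1ℤ)
open import Data.Integer.Tactic.RingSolver using (solve-∀)
open import Data.Nat.Base using (ℕ; zero; suc; _+_; _*_; _∸_; _≤_; _<_; _/_)
open import Data.Product.Base using (Σ; ∃; ∃₂; _×_; _,_)
open import Data.Sum.Base using (_⊎_)
open import Data.Unit.Base using (⊤; tt)
open import Level using (0ℓ)
open import Relation.Binary.Core using (Rel)
open import Relation.Binary.Construct.Closure.Symmetric using (SymClosure)
open import Relation.Binary.PropositionalEquality
  using (_≡_; trans; cong; cong₂; isEquivalence)
open import Relation.Nullary.Negation.Core using (¬_)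
open import Relation.Unary using (Pred; _∈_; _∉_; _≐_)

------------------------------------------------------------------------
-- Ideals and ideal classes

module Ideals (R : CommutativeRing 0ℓ 0ℓ) where

  open CommutativeRing R
    renaming ( Carrier to A; _+_ to _+ᴿ_; _*_ to _*ᴿ_; refl to ≈-refl
             ; sym to ≈-sym; trans to ≈-trans)

  record Ideal : Set₁ where
    field
      member     : Pred A 0ℓ
      respects   : ∀ {x y} → x ≈ y → x ∈ member → y ∈ member
      0#-closed  : 0# ∈ member
      +-closed   : ∀ {x y} → x ∈ member → y ∈ member → x +ᴿ y ∈ member
      *-closed   : ∀ r {x} → x ∈ member → r *ᴿ x ∈ member

  open Ideal public using (member)

  record IsPrime (P : Ideal) : Set where
    field
      proper : 1# ∉ member P
      split  : ∀ {x y} → x *ᴿ y ∈ member P → x ∈ member P ⊎ y ∈ member P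

  unitIdeal : Ideal
  unitIdeal = record
    { member = λ _ → ⊤ ; respects = λ _ _ → tt ; 0#-closed = tt
    ; +-closed = λ _ _ → tt ; *-closed = λ _ _ → tt }

  principal : A → Ideal
  principal a = record
    { member    = λ x → ∃ λ r → x ≈ r *ᴿ a
    ; respects  = λ { x≈y (r , e) → r , ≈-trans (≈-sym x≈y) e }
    ; 0#-closed = 0# , ≈-sym (zeroˡ a)
    ; +-closed  = λ { (r , e) (s , f) →
                      r +ᴿ s , ≈-trans (+-cong e f) (≈-sym (distribʳ a r s)) }
    ; *-closed  = λ { t (r , e) →
                      t *ᴿ r , ≈-trans (*-cong ≈-refl e) (≈-sym (*-assoc t r a)) }
    }

  -- Finite sums of products of an element of I by an element of J.
  data ProductMember (I J : Ideal) : Pred A 0ℓ where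
    nil  : ∀ {x} → x ≈ 0# → ProductMember I J x
    cons : ∀ {x a b s} → a ∈ member I → b ∈ member J →
           ProductMember I J s → x ≈ a *ᴿ b +ᴿ s → ProductMember I J x

  infixl 7 _·_
  infixr 8 _^ᴵ_

  _·_ : Ideal → Ideal → Ideal
  I · J = record
    { member    = ProductMember I J
    ; respects  = resp
    ; 0#-closed = nil ≈-refl
    ; +-closed  = add
    ; *-closed  = mul
    }
    where
    M : Pred A 0ℓ
    M = ProductMember I J

    resp : ∀ {x y} → x ≈ y → x ∈ M → y ∈ M
    resp x≈y (nil e)          = nil (≈-trans (≈-sym x≈y) e)
    resp x≈y (cons a∈ b∈ s e) = cons a∈ b∈ s (≈-trans (≈-sym x≈y) e)

    add : ∀ {x y} → x ∈ M → y ∈ M → x +ᴿ y ∈ M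
    add {y = y} (nil e) q =
      resp (≈-sym (≈-trans (+-cong e ≈-refl) (+-identityˡ y))) q
    add (cons a∈ b∈ s e) q =
      cons a∈ b∈ (add s q) (≈-trans (+-cong e ≈-refl) (+-assoc _ _ _))

    mul : ∀ r {x} → x ∈ M → r *ᴿ x ∈ M
    mul r (nil e) = nil (≈-trans (*-cong ≈-refl e) (zeroʳ r))
    mul r (cons a∈ b∈ s e) =
      cons (Ideal.*-closed I r a∈) b∈ (mul r s)
        (≈-trans (*-cong ≈-refl e)
          (≈-trans (distribˡ r _ _) (+-cong (≈-sym (*-assoc r _ _)) ≈-refl)))

  _^ᴵ_ : Ideal → ℕ → Ideal
  I ^ᴵ zero  = unitIdeal
  I ^ᴵ suc n = I · I ^ᴵ n

  -- Equality in the ideal class group: aI = bJ for some nonzero a and b.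
  infix 4 _∼_
  _∼_ : Rel Ideal 0ℓ
  I ∼ J = ∃₂ λ a b → ¬ (a ≈ 0#) × ¬ (b ≈ 0#) ×
          member (principal a · I) ≐ member (principal b · J)

  record IsClassOrder (I : Ideal) (n : ℕ) : Set where
    field
      positive : 0 < n
      trivial  : I ^ᴵ n ∼ unitIdeal
      least    : ∀ {m} → 0 < m → m < n → ¬ (I ^ᴵ m ∼ unitIdeal)

------------------------------------------------------------------------
-- Imaginary quadratic orders

-- re + im ω, in the ring ℤ[ω] with ω² = ω - c, of discriminant 1 - 4c.
record Quad (c : ℤ) : Set where
  constructor _+_ω
  field
    re im : ℤ

module _ (c : ℤ) where

  private
    infixl 6 _⊕_
    infixl 7 _⊗_

    _⊕_ _⊗_ : Quad c → Quad c → Quad c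
    (a + b ω) ⊕ (a′ + b′ ω) = (a ℤ.+ a′) + (b ℤ.+ b′) ω
    (a + b ω) ⊗ (a′ + b′ ω) =
      (a ℤ.* a′ ℤ.- c ℤ.* (b ℤ.* b′)) +
      (a ℤ.* b′ ℤ.+ b ℤ.* a′ ℤ.+ b ℤ.* b′) ω

    ⊖_ : Quad c → Quad c
    ⊖ (a + b ω) = (ℤ.- a) + (ℤ.- b) ω

    𝟘 𝟙 : Quad c
    𝟘 = 0ℤ + 0ℤ ω
    𝟙 = 1ℤ + 0ℤ ω

    quad≡ : ∀ {a a′ b b′} → a ≡ a′ → b ≡ b′ →
            _≡_ {A = Quad c} (a + b ω) (a′ + b′ ω)
    quad≡ = cong₂ _+_ω

    +-assoc₁ : ∀ a b d → a ℤ.+ b ℤ.+ d ≡ a ℤ.+ (b ℤ.+ d)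
    +-assoc₁ = solve-∀

    +-comm₁ : ∀ a b → a ℤ.+ b ≡ b ℤ.+ a
    +-comm₁ = solve-∀

    +-id₁ : ∀ a → 0ℤ ℤ.+ a ≡ a
    +-id₁ = solve-∀

    +-inv₁ : ∀ a → ℤ.- a ℤ.+ a ≡ 0ℤ
    +-inv₁ = solve-∀

    ⊗-assoc-re : ∀ c a b d e f g →
      (a ℤ.* d ℤ.- c ℤ.* (b ℤ.* e)) ℤ.* f
        ℤ.- c ℤ.* ((a ℤ.* e ℤ.+ b ℤ.* d ℤ.+ b ℤ.* e) ℤ.* g) ≡
      a ℤ.* (d ℤ.* f ℤ.- c ℤ.* (e ℤ.* g))
        ℤ.- c ℤ.* (b ℤ.* (d ℤ.* g ℤ.+ e ℤ.* f ℤ.+ e ℤ.* g))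
    ⊗-assoc-re = solve-∀

    ⊗-assoc-im : ∀ c a b d e f g →
      (a ℤ.* d ℤ.- c ℤ.* (b ℤ.* e)) ℤ.* g
        ℤ.+ (a ℤ.* e ℤ.+ b ℤ.* d ℤ.+ b ℤ.* e) ℤ.* f
        ℤ.+ (a ℤ.* e ℤ.+ b ℤ.* d ℤ.+ b ℤ.* e) ℤ.* g ≡
      a ℤ.* (d ℤ.* g ℤ.+ e ℤ.* f ℤ.+ e ℤ.* g)
        ℤ.+ b ℤ.* (d ℤ.* f ℤ.- c ℤ.* (e ℤ.* g))
        ℤ.+ b ℤ.* (d ℤ.* g ℤ.+ e ℤ.* f ℤ.+ e ℤ.* g)
    ⊗-assoc-im = solve-∀

    ⊗-comm-re : ∀ c a b d e →
      a ℤ.* d ℤ.- c ℤ.* (b ℤ.* e) ≡ d ℤ.* a ℤ.- c ℤ.* (e ℤ.* b)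
    ⊗-comm-re = solve-∀

    ⊗-comm-im : ∀ a b d e →
      a ℤ.* e ℤ.+ b ℤ.* d ℤ.+ b ℤ.* e ≡ d ℤ.* b ℤ.+ e ℤ.* a ℤ.+ e ℤ.* b
    ⊗-comm-im = solve-∀

    ⊗-id-re : ∀ c a b → 1ℤ ℤ.* a ℤ.- c ℤ.* (0ℤ ℤ.* b) ≡ a
    ⊗-id-re = solve-∀

    ⊗-id-im : ∀ a b → 1ℤ ℤ.* b ℤ.+ 0ℤ ℤ.* a ℤ.+ 0ℤ ℤ.* b ≡ b
    ⊗-id-im = solve-∀

    distrib-re : ∀ c a b d e f g →
      a ℤ.* (d ℤ.+ f) ℤ.- c ℤ.* (b ℤ.* (e ℤ.+ g)) ≡
      (a ℤ.* d ℤ.- c ℤ.* (b ℤ.* e)) ℤ.+ (a ℤ.* f ℤ.- c ℤ.* (b ℤ.* g))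
    distrib-re = solve-∀

    distrib-im : ∀ a b d e f g →
      a ℤ.* (e ℤ.+ g) ℤ.+ b ℤ.* (d ℤ.+ f) ℤ.+ b ℤ.* (e ℤ.+ g) ≡
      (a ℤ.* e ℤ.+ b ℤ.* d ℤ.+ b ℤ.* e) ℤ.+ (a ℤ.* g ℤ.+ b ℤ.* f ℤ.+ b ℤ.* g)
    distrib-im = solve-∀

    ⊕-assoc : ∀ x y z → (x ⊕ y) ⊕ z ≡ x ⊕ (y ⊕ z)
    ⊕-assoc (a + b ω) (d + e ω) (f + g ω) =
      quad≡ (+-assoc₁ a d f) (+-assoc₁ b e g)

    ⊕-comm : ∀ x y → x ⊕ y ≡ y ⊕ x
    ⊕-comm (a + b ω) (d + e ω) = quad≡ (+-comm₁ a d) (+-comm₁ b e)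

    ⊕-idˡ : ∀ x → 𝟘 ⊕ x ≡ x
    ⊕-idˡ (a + b ω) = quad≡ (+-id₁ a) (+-id₁ b)

    ⊖-invˡ : ∀ x → (⊖ x) ⊕ x ≡ 𝟘
    ⊖-invˡ (a + b ω) = quad≡ (+-inv₁ a) (+-inv₁ b)

    ⊗-assoc : ∀ x y z → (x ⊗ y) ⊗ z ≡ x ⊗ (y ⊗ z)
    ⊗-assoc (a + b ω) (d + e ω) (f + g ω) =
      quad≡ (⊗-assoc-re c a b d e f g) (⊗-assoc-im c a b d e f g)

    ⊗-comm : ∀ x y → x ⊗ y ≡ y ⊗ x
    ⊗-comm (a + b ω) (d + e ω) =
      quad≡ (⊗-comm-re c a b d e) (⊗-comm-im a b d e)

    ⊗-idˡ : ∀ x → 𝟙 ⊗ x ≡ x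
    ⊗-idˡ (a + b ω) = quad≡ (⊗-id-re c a b) (⊗-id-im a b)

    distribˡ : ∀ x y z → x ⊗ (y ⊕ z) ≡ (x ⊗ y) ⊕ (x ⊗ z)
    distribˡ (a + b ω) (d + e ω) (f + g ω) =
      quad≡ (distrib-re c a b d e f g) (distrib-im a b d e f g)

    isCommutativeRing : IsCommutativeRing _≡_ _⊕_ _⊗_ ⊖_ 𝟘 𝟙
    isCommutativeRing = record
      { isRing = record
        { +-isAbelianGroup = record
          { isGroup = record
            { isMonoid = record
              { isSemigroup = record
                { isMagma = record
                  { isEquivalence = isEquivalence ; ∙-cong = cong₂ _⊕_ }
                ; assoc = ⊕-assoc }
              ; identity = ⊕-idˡ , λ x → trans (⊕-comm x 𝟘) (⊕-idˡ x) }
            ; inverse = ⊖-invˡ , λ x → trans (⊕-comm x (⊖ x)) (⊖-invˡ x)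
            ; ⁻¹-cong = cong ⊖_ }
          ; comm = ⊕-comm }
        ; *-cong = cong₂ _⊗_
        ; *-assoc = ⊗-assoc
        ; *-identity = ⊗-idˡ , λ x → trans (⊗-comm x 𝟙) (⊗-idˡ x)
        ; distrib = distribˡ , λ x y z →
            trans (⊗-comm (y ⊕ z) x)
              (trans (distribˡ x y z) (cong₂ _⊕_ (⊗-comm x y) (⊗-comm x z)))
        }
      ; *-comm = ⊗-comm }

  quadRing : CommutativeRing 0ℓ 0ℓ
  quadRing = record { isCommutativeRing = isCommutativeRing }

-- For a prime p ≡ 3 (mod 4), the ring of integers of ℚ(√-p) is
-- ℤ[(1 + √-p)/2], and ω = (1 + √-p)/2 satisfies ω² = ω - (p + 1)/4.
-- The division by 4 is exact for such p.
𝓞 : ℕ → CommutativeRing 0ℓ 0ℓ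
𝓞 p = quadRing (+ (suc p / 4))

-- L is the order, in the ideal class group of ℚ(√-p), of some prime ideal
-- containing 2.
IsOrd₂ : ℕ → ℕ → Set₁
IsOrd₂ p L = Σ Ideal λ P → IsPrime P × (1# +ᴿ 1#) ∈ member P × IsClassOrder P L
  where
  open Ideals (𝓞 p)
  open CommutativeRing (𝓞 p) using (1#) renaming (_+_ to _+ᴿ_)

------------------------------------------------------------------------
-- Graph distance

module Graph {V : Set} (Adj : Rel V 0ℓ) where

  data Walk : ℕ → Rel V 0ℓ where
    []  : ∀ {u} → Walk 0 u u
    _∷_ : ∀ {n u v w} → Adj u v → Walk n v w → Walk (suc n) u w

  record IsDistance (u v : V) (d : ℕ) : Set where
    field
      walk     : Walk d u v
      shortest : ∀ {n} → Walk n u v → d ≤ n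

  record IsDiameter (d : ℕ) : Set where
    field
      attained : ∃₂ λ u v → IsDistance u v d
      bound    : ∀ u v → ∃ λ e → IsDistance u v e × e ≤ d

------------------------------------------------------------------------
-- The stacked component

module _ (L : ℕ) where

  -- i + 1 < L is i ≤ L - 2, avoiding truncated subtraction.
  data Edge : Rel ℕ 0ℓ where
    spoke : ∀ {i} → i < L → Edge (2 * i) (2 * i + 1)
    rim   : ∀ {i} → i + 1 < L → Edge (2 * i + 1) (2 * i + 3)
    close : Edge (2 * L ∸ 1) 1

  -- The only degenerate cases (a loop for L = 1, a doubled edge for L = 2)
  -- change no distance.
  Stacked : Rel (Fin (2 * L)) 0ℓ
  Stacked u v = SymClosure Edge (toℕ u) (toℕ v)

{-# OPTIONS --safe #-}

-- Let c = (p + 1) / 4 and let P be a prime above 2, with conjugate Q. Since c is even, P + Q = (1)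
-- and PQ ⊆ (2), and Pⁿ is principal exactly when 2ⁿ = N(x + y ω) for some odd y, that is, when
-- 4 · 2ⁿ = X² + p Y² with X and Y odd. For n = 1 this is impossible because p > 8. For n = 2m it reads
-- (T - X)(T + X) = p Y² with T = 2 · 2ᵐ; the factors are coprime, hence are v² and p u² in some
-- order, and their sum 4 · 2ᵐ = v² + p u² makes Pᵐ principal. So the order of P is odd and at
-- least 3.
--
-- For L = 2k + 3 the rim is an odd cycle of diameter k + 1, and a spoke at each end adds 2.

module Submission where

open import Defs
open import Algebra.Bundles using (CommutativeRing)
open import Data.Empty using (⊥-elim)
open import Data.Fin.Base using (Fin; toℕ; fromℕ<)
import Data.Fin.Properties as Fin
open import Data.Integer.Base as ℤ using (ℤ; +_; 0ℤ; 1ℤ; ∣_∣)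
import Data.Integer.DivMod as ℤ
import Data.Integer.Properties as ℤ
open import Data.Integer.Tactic.RingSolver using (solve-∀)
open import Data.Nat as ℕ
  using (ℕ; zero; suc; _+_; _*_; _∸_; _^_; _/_; _%_; _⊓_; _≤_; _<_; z≤n; s≤s; NonZero)
open import Data.Nat.Coprimality as Coprimality using (Coprime; coprime-divisor; coprime-/gcd)
open import Data.Nat.Divisibility
  using ( _∣_; divides; ∣1⇒≡1; ∣-trans; ∣-antisym; m∣m*n; n∣m*n; ∣m⇒∣m*n; ∣n⇒∣m*n
        ; ∣m+n∣m⇒∣n; ∣m∣n⇒∣m+n )
open import Data.Nat.DivMod
  using (m*n/n≡m; m/n*n≡m; m≡m%n+[m/n]*n; m%n<n; [m+kn]%n≡m%n; m*n%n≡0; +-distrib-/-∣ʳ)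
open import Data.Nat.GCD using (gcd; gcd[m,n]∣m; gcd[m,n]∣n; gcd[m,n]≢0)
open import Data.Nat.Primality
  using (Prime; prime[2]; prime⇒irreducible; prime⇒nonZero; euclidsLemma)
import Data.Nat.Properties as ℕ
import Data.Nat.Tactic.RingSolver as ℕ-Solver
open import Data.Product using (∃; ∃₂; _×_; _,_; proj₁; proj₂)
open import Data.Sum using (_⊎_; inj₁; inj₂; [_,_]′)
open import Data.Unit.Base using (tt)
open import Function.Base using (_∘_)
open import Level using (0ℓ)
open import Relation.Binary.Construct.Closure.Symmetric using (fwd; bwd)
import Relation.Binary.Construct.Closure.Symmetric as SymClosure
open import Relation.Binary.Core using (Rel)
open import Relation.Binary.Definitions using (Decidable; Symmetric)
open import Relation.Binary.PropositionalEquality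
  using (_≡_; refl; sym; trans; cong; cong₂; subst; subst₂; module ≡-Reasoning)
open import Relation.Nullary using (Dec; yes; no; ¬_)
open import Relation.Nullary.Decidable as Dec using (_×-dec_; _⊎-dec_)
open import Relation.Unary using (_∈_)

-- Powers of ideals

-- The criterion for Pⁿ to be principal is proved with elements alone, without norms or unique
-- factorization of ideals. If α generates Pⁿ, then αᾱ ∈ (2ⁿ) and 2ⁿ ∈ (α), which determines N(α) up
-- to an integer factor; oddness of y, which expresses that α avoids Q, forces this factor to be a
-- unit. Conversely, an element β of norm 2ⁿ outside Q has β̄ ≡ 1 modulo P, so β̄ can be cancelled
-- from β̄β = 2ⁿ ∈ Pⁿ. The descent must keep both variables odd: this makes T - X and T + X coprime,
-- and it lets the new solution be read again as an element x + y ω.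

module IdealPowers (R : CommutativeRing 0ℓ 0ℓ) where

  open CommutativeRing R
    renaming ( _+_ to _+ᴿ_; _*_ to _*ᴿ_; refl to ≈-refl; sym to ≈-sym; trans to ≈-trans )
  open Ideals R
  open import Algebra.Properties.Semiring.Exp semiring using () renaming (_^_ to _^ᴿ_)
  open import Algebra.Properties.CommutativeSemigroup *-commutativeSemigroup
    using (interchange; x∙yz≈y∙xz; xy∙z≈y∙xz)
  open import Relation.Binary.Reasoning.Setoid setoid

  open Ideal using (respects; 0#-closed; +-closed; *-closed)

  ·-intro : ∀ {I J : Ideal} {x y} → x ∈ member I → y ∈ member J → x *ᴿ y ∈ member (I · J)
  ·-intro x∈ y∈ = cons x∈ y∈ (nil ≈-refl) (≈-sym (+-identityʳ _))

  -- The only induction over the finite sums in a product ideal. Later inclusions choose a suitable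
  -- ideal `K` and check products of two elements.
  ·-least : ∀ {I J} K → (∀ {x y} → x ∈ member I → y ∈ member J → x *ᴿ y ∈ member K) →
            ∀ {z} → z ∈ member (I · J) → z ∈ member K
  ·-least K f (nil e)            = respects K (≈-sym e) (0#-closed K)
  ·-least K f (cons x∈ y∈ s∈ e) =
    respects K (≈-sym e) (+-closed K (f x∈ y∈) (·-least K f s∈))

  ^-intro : ∀ {I x} n → x ∈ member I → x ^ᴿ n ∈ member (I ^ᴵ n)
  ^-intro zero    x∈ = tt
  ^-intro (suc n) x∈ = ·-intro x∈ (^-intro n x∈)

  ·⊆ˡ : ∀ {I J x} → x ∈ member (I · J) → x ∈ member I
  ·⊆ˡ {I} = ·-least I (λ x∈ _ → respects I (*-comm _ _) (*-closed I _ x∈))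

  -- v = 1 - u is invertible modulo Iⁿ.
  ^-cancel-unit : ∀ {I u v x} n → u ∈ member I → u +ᴿ v ≈ 1# →
                  v *ᴿ x ∈ member (I ^ᴵ n) → x ∈ member (I ^ᴵ n)
  ^-cancel-unit {I} {u} {v} {x} n u∈ u+v≈1 vx∈ =
    -- Start from uⁿx ∈ Iⁿ and lower the exponent to 0: since u + v = 1, u^k x is the sum of u^(k+1)
    -- x and u^k (v x), both in Iⁿ.
    go n (respects (I ^ᴵ n) (*-comm _ _) (*-closed (I ^ᴵ n) x (^-intro n u∈)))
    where
    expand : ∀ k → u ^ᴿ suc k *ᴿ x +ᴿ u ^ᴿ k *ᴿ (v *ᴿ x) ≈ u ^ᴿ k *ᴿ x
    expand k = begin
      u *ᴿ u ^ᴿ k *ᴿ x +ᴿ u ^ᴿ k *ᴿ (v *ᴿ x)    ≈⟨ +-cong (*-assoc u (u ^ᴿ k) x) (x∙yz≈y∙xz (u ^ᴿ k) v x) ⟩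
      u *ᴿ (u ^ᴿ k *ᴿ x) +ᴿ v *ᴿ (u ^ᴿ k *ᴿ x) ≈⟨ distribʳ _ u v ⟨
      (u +ᴿ v) *ᴿ (u ^ᴿ k *ᴿ x)                ≈⟨ *-congʳ u+v≈1 ⟩
      1# *ᴿ (u ^ᴿ k *ᴿ x)                      ≈⟨ *-identityˡ _ ⟩
      u ^ᴿ k *ᴿ x                              ∎
    go : ∀ k → u ^ᴿ k *ᴿ x ∈ member (I ^ᴵ n) → x ∈ member (I ^ᴵ n)
    go zero    h = respects (I ^ᴵ n) (*-identityˡ x) h
    go (suc k) h = go k (respects (I ^ᴵ n) (expand k)
      (+-closed (I ^ᴵ n) h (*-closed (I ^ᴵ n) (u ^ᴿ k) vx∈)))

  ^-product-⊆ : ∀ {I J t} → (∀ {x y} → x ∈ member I → y ∈ member J → x *ᴿ y ∈ member (principal t)) →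
                ∀ n {x y} → x ∈ member (I ^ᴵ n) → y ∈ member (J ^ᴵ n) →
                x *ᴿ y ∈ member (principal (t ^ᴿ n))
  ^-product-⊆ IJ⊆t zero    x∈ y∈ = _ , ≈-sym (*-identityʳ _)
  -- Both arguments are sums of products. `·-least` treats one at a time, with the other held fixed
  -- in a colon ideal (T : y); commutativity exchanges their roles in between.
  ^-product-⊆ {I} {J} {t} IJ⊆t (suc n) {x} {y} x∈ y∈ =
    ·-least (colon y)
      (λ {a} {b} a∈ b∈ → respects T (*-comm _ _)
        (·-least (colon (a *ᴿ b))
          (λ {d} {e} d∈ e∈ → let (r , ad) = IJ⊆t a∈ d∈ ; (s , be) = ^-product-⊆ IJ⊆t n b∈ e∈ in
            r *ᴿ s , (begin
              d *ᴿ e *ᴿ (a *ᴿ b)       ≈⟨ ≈-trans (*-comm _ _) (interchange a b d e) ⟩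
              a *ᴿ d *ᴿ (b *ᴿ e)       ≈⟨ *-cong ad be ⟩
              r *ᴿ t *ᴿ (s *ᴿ t ^ᴿ n)  ≈⟨ interchange r t s (t ^ᴿ n) ⟩
              r *ᴿ s *ᴿ (t *ᴿ t ^ᴿ n)  ∎))
          y∈))
      x∈
    where
    T : Ideal
    T = principal (t ^ᴿ suc n)
    colon : Carrier → Ideal
    colon y = record
      { member    = λ x → x *ᴿ y ∈ member T
      ; respects  = λ e → respects T (*-congʳ e)
      ; 0#-closed = respects T (≈-sym (zeroˡ y)) (0#-closed T)
      ; +-closed  = λ p q → respects T (≈-sym (distribʳ y _ _)) (+-closed T p q)
      ; *-closed  = λ r p → respects T (≈-sym (*-assoc r _ y)) (*-closed T r p)
      }

  generated⇒trivial : ∀ {I α} → ¬ (1# ≈ 0#) → ¬ (α ≈ 0#) → α ∈ member I →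
                      (∀ {z} → z ∈ member I → z ∈ member (principal α)) → I ∼ unitIdeal
  generated⇒trivial {I} {α} 1≉0 α≉0 α∈ I⊆α = 1# , α , 1≉0 , α≉0 , to , from
    where
    to : ∀ {z} → z ∈ member (principal 1# · I) → z ∈ member (principal α · unitIdeal)
    to z∈ = let (s , e) = ·-least (principal α) (λ {x} _ y∈ → *-closed (principal α) x (I⊆α y∈)) z∈ in
      respects (principal α · unitIdeal) (≈-trans (*-identityʳ _) (≈-sym e))
        (·-intro {principal α} {unitIdeal} {s *ᴿ α} {1#} (s , ≈-refl) tt)
    from : ∀ {z} → z ∈ member (principal α · unitIdeal) → z ∈ member (principal 1# · I)
    from z∈ = let (s , e) = ·⊆ˡ {principal α} {unitIdeal} z∈ in
      respects (principal 1# · I) (≈-trans (*-identityˡ _) (≈-sym e))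
        (·-intro {principal 1#} {I} (1# , ≈-sym (*-identityʳ 1#)) (*-closed I s α∈))

  -- From aI = (b) one gets b = aα with α ∈ I. For z ∈ I, az = sb = a(sα), and cancelling a leaves z
  -- = sα. The ideal `aI` in the proof is a·I with each member written as a single multiple of a, so
  -- that α can be extracted.
  trivial⇒generated : (∀ {a x y} → ¬ (a ≈ 0#) → a *ᴿ x ≈ a *ᴿ y → x ≈ y) → ∀ {I} → I ∼ unitIdeal →
                      ∃ λ α → ¬ (α ≈ 0#) × α ∈ member I × (∀ {z} → z ∈ member I → z ∈ member (principal α))
  trivial⇒generated cancel {I} (a , b , a≉0 , b≉0 , to , from) = α , α≉0 , α∈ , I⊆α
    where
    aI : Ideal
    aI = record
      { member    = λ z → ∃ λ y → y ∈ member I × z ≈ a *ᴿ y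
      ; respects  = λ { e (y , y∈ , f) → y , y∈ , ≈-trans (≈-sym e) f }
      ; 0#-closed = 0# , 0#-closed I , ≈-sym (zeroʳ a)
      ; +-closed  = λ { (y , y∈ , f) (w , w∈ , g) →
                        y +ᴿ w , +-closed I y∈ w∈ , ≈-trans (+-cong f g) (≈-sym (distribˡ a y w)) }
      ; *-closed  = λ { r (y , y∈ , f) → r *ᴿ y , *-closed I r y∈ , ≈-trans (*-congˡ f) (x∙yz≈y∙xz r a y) }
      }
    b∈aI : b ∈ member aI
    b∈aI = ·-least {principal a} {I} aI
      (λ { {x} {y} (r , e) y∈ → r *ᴿ y , *-closed I r y∈ , ≈-trans (*-congʳ e) (xy∙z≈y∙xz r a y) })
      (from (respects (principal b · unitIdeal) (≈-trans (*-identityʳ _) (*-identityˡ b))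
        (·-intro {principal b} {unitIdeal} {1# *ᴿ b} {1#} (1# , ≈-refl) tt)))
    α : Carrier
    α = b∈aI .proj₁
    α∈ : α ∈ member I
    α∈ = b∈aI .proj₂ .proj₁
    α≉0 : ¬ (α ≈ 0#)
    α≉0 α≈0 = b≉0 (≈-trans (b∈aI .proj₂ .proj₂) (≈-trans (*-congˡ α≈0) (zeroʳ a)))
    I⊆α : ∀ {z} → z ∈ member I → z ∈ member (principal α)
    I⊆α {z} z∈ = let (s , e) = ·⊆ˡ {principal b} {unitIdeal}
                                  (to (·-intro {principal a} {I} {a} {z} (1# , ≈-sym (*-identityˡ a)) z∈)) in
      s , cancel a≉0 (begin
        a *ᴿ z         ≈⟨ e ⟩
        s *ᴿ b         ≈⟨ *-congˡ (b∈aI .proj₂ .proj₂) ⟩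
        s *ᴿ (a *ᴿ α)  ≈⟨ x∙yz≈y∙xz s a α ⟩
        a *ᴿ (s *ᴿ α)  ∎)

-- Ideals above 2 in a quadratic order

-- With oddness as evenness of 1 - a, parity arguments reduce to `even+`, `even-` and a ring
-- identity.
Even Odd : ℤ → Set
Even a = ∃ λ k → k ℤ.* + 2 ≡ a
Odd a = Even (1ℤ ℤ.- a)

even⊎odd : ∀ a → Even a ⊎ Odd a
even⊎odd a with a ℤ.%ℕ 2 | ℤ.n%ℕd<d a 2 | ℤ.a≡a%ℕn+[a/ℕn]*n a 2
... | 0 | _ | e = inj₁ (a ℤ./ℕ 2 , trans (sym (ℤ.+-identityˡ _)) (sym e))
... | 1 | _ | e = inj₂ (ℤ.- (a ℤ./ℕ 2) , trans (eq (a ℤ./ℕ 2)) (cong (λ z → 1ℤ ℤ.- z) (sym e)))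
  where
  eq : ∀ q → ℤ.- q ℤ.* + 2 ≡ 1ℤ ℤ.- (1ℤ ℤ.+ q ℤ.* + 2)
  eq = solve-∀
... | suc (suc _) | s≤s (s≤s ()) | _

¬even-1 : ¬ Even 1ℤ
¬even-1 (k , e) with ∣ k ∣ | trans (sym (ℤ.abs-* k (+ 2))) (cong ∣_∣ e)
... | zero        | ()
... | suc zero    | ()
... | suc (suc _) | ()

even+ : ∀ {a b} → Even a → Even b → Even (a ℤ.+ b)
even+ (k , refl) (l , refl) = k ℤ.+ l , ℤ.*-distribʳ-+ (+ 2) k l

even- : ∀ {a} → Even a → Even (ℤ.- a)
even- (k , refl) = ℤ.- k , sym (ℤ.neg-distribˡ-* k (+ 2))

¬even∧odd : ∀ {a} → Even a → ¬ Odd a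
¬even∧odd {a} e o = ¬even-1 (subst Even (eq a) (even+ e o))
  where
  eq : ∀ a → a ℤ.+ (1ℤ ℤ.- a) ≡ 1ℤ
  eq = solve-∀

odd⇒2∤∣∣ : ∀ {a} → Odd a → ¬ 2 ∣ ∣ a ∣
odd⇒2∤∣∣ {a} o (divides q e) = ¬even∧odd (even a (+ q , trans (sym (ℤ.pos-* q 2)) (cong +_ (sym e)))) o
  where
  even : ∀ a → Even (+ ∣ a ∣) → Even a
  even (+ n)        h = h
  even (ℤ.-[1+ n ]) h = even- h

odd-divisor-2^ : ∀ {d} k → ¬ 2 ∣ d → d ∣ 2 ^ k → d ≡ 1
odd-divisor-2^ zero    2∤d d∣ = ∣1⇒≡1 d∣
odd-divisor-2^ {d} (suc k) 2∤d d∣ = odd-divisor-2^ k 2∤d (coprime-divisor d⊥2 d∣)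
  where
  d⊥2 : Coprime d 2
  d⊥2 (e∣d , e∣2) with prime⇒irreducible prime[2] e∣2
  ... | inj₁ e≡1 = e≡1
  ... | inj₂ refl = ⊥-elim (2∤d e∣d)

-- Norm and conjugation in ℤ[ω]

module Quadratic (c : ℤ) where

  open CommutativeRing (quadRing c) using (semiring; *-identityʳ; *-comm; *-assoc; 1#; 0#)
    renaming (_+_ to _⊕_; _*_ to _⊗_)
  open Ideals (quadRing c)
  open IdealPowers (quadRing c)
  open Ideal using (respects; 0#-closed; +-closed; *-closed)
  import Algebra.Properties.Semiring.Exp semiring as Exp

  ⟦_⟧ : ℤ → Quad c
  ⟦ n ⟧ = n + 0ℤ ω

  norm : Quad c → ℤ
  norm (a + b ω) = a ℤ.* a ℤ.+ a ℤ.* b ℤ.+ c ℤ.* (b ℤ.* b)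

  conj : Quad c → Quad c
  conj (a + b ω) = (a ℤ.+ b) + (ℤ.- b) ω

  conj-⊕ : ∀ x y → conj (x ⊕ y) ≡ conj x ⊕ conj y
  conj-⊕ (a + b ω) (d + e ω) = cong₂ _+_ω (eq₁ a b d e) (eq₂ b e)
    where
    eq₁ : ∀ a b d e → a ℤ.+ d ℤ.+ (b ℤ.+ e) ≡ a ℤ.+ b ℤ.+ (d ℤ.+ e)
    eq₁ = solve-∀
    eq₂ : ∀ b e → ℤ.- (b ℤ.+ e) ≡ ℤ.- b ℤ.+ ℤ.- e
    eq₂ = solve-∀

  conj-⊗ : ∀ x y → conj (x ⊗ y) ≡ conj x ⊗ conj y
  conj-⊗ (a + b ω) (d + e ω) = cong₂ _+_ω (eq₁ c a b d e) (eq₂ a b d e)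
    where
    eq₁ : ∀ c a b d e → a ℤ.* d ℤ.- c ℤ.* (b ℤ.* e) ℤ.+ (a ℤ.* e ℤ.+ b ℤ.* d ℤ.+ b ℤ.* e) ≡
                        (a ℤ.+ b) ℤ.* (d ℤ.+ e) ℤ.- c ℤ.* (ℤ.- b ℤ.* ℤ.- e)
    eq₁ = solve-∀
    eq₂ : ∀ a b d e → ℤ.- (a ℤ.* e ℤ.+ b ℤ.* d ℤ.+ b ℤ.* e) ≡
                      (a ℤ.+ b) ℤ.* ℤ.- e ℤ.+ ℤ.- b ℤ.* (d ℤ.+ e) ℤ.+ ℤ.- b ℤ.* ℤ.- e
    eq₂ = solve-∀

  conj-involutive : ∀ x → conj (conj x) ≡ x
  conj-involutive (a + b ω) = cong₂ _+_ω (eq a b) (ℤ.neg-involutive b)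
    where
    eq : ∀ a b → a ℤ.+ b ℤ.+ ℤ.- b ≡ a
    eq = solve-∀

  conj-norm : ∀ x → x ⊗ conj x ≡ ⟦ norm x ⟧
  conj-norm (a + b ω) = cong₂ _+_ω (eq₁ c a b) (eq₂ a b)
    where
    eq₁ : ∀ c a b → a ℤ.* (a ℤ.+ b) ℤ.- c ℤ.* (b ℤ.* ℤ.- b) ≡
                    a ℤ.* a ℤ.+ a ℤ.* b ℤ.+ c ℤ.* (b ℤ.* b)
    eq₁ = solve-∀
    eq₂ : ∀ a b → a ℤ.* ℤ.- b ℤ.+ b ℤ.* (a ℤ.+ b) ℤ.+ b ℤ.* ℤ.- b ≡ 0ℤ
    eq₂ = solve-∀

  norm-conj : ∀ x → norm (conj x) ≡ norm x
  norm-conj (a + b ω) = eq c a b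
    where
    eq : ∀ c a b → (a ℤ.+ b) ℤ.* (a ℤ.+ b) ℤ.+ (a ℤ.+ b) ℤ.* ℤ.- b ℤ.+ c ℤ.* (ℤ.- b ℤ.* ℤ.- b) ≡
                   a ℤ.* a ℤ.+ a ℤ.* b ℤ.+ c ℤ.* (b ℤ.* b)
    eq = solve-∀

  ⟦⟧-⊗ : ∀ n x → ⟦ n ⟧ ⊗ x ≡ (n ℤ.* Quad.re x) + (n ℤ.* Quad.im x) ω
  ⟦⟧-⊗ n (a + b ω) = cong₂ _+_ω (eq₁ c n a b) (eq₂ n a b)
    where
    eq₁ : ∀ c n a b → n ℤ.* a ℤ.- c ℤ.* (0ℤ ℤ.* b) ≡ n ℤ.* a
    eq₁ = solve-∀
    eq₂ : ∀ n a b → n ℤ.* b ℤ.+ 0ℤ ℤ.* a ℤ.+ 0ℤ ℤ.* b ≡ n ℤ.* b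
    eq₂ = solve-∀

  ⟦⟧-*-homo : ∀ m n → ⟦ m ⟧ ⊗ ⟦ n ⟧ ≡ ⟦ m ℤ.* n ⟧
  ⟦⟧-*-homo m n = trans (⟦⟧-⊗ m ⟦ n ⟧) (cong ((m ℤ.* n) +_ω) (ℤ.*-zeroʳ m))

  ⟦⟧-^ : ∀ n → ⟦ + 2 ⟧ Exp.^ n ≡ ⟦ + (2 ^ n) ⟧
  ⟦⟧-^ zero    = refl
  ⟦⟧-^ (suc n) = trans (cong (⟦ + 2 ⟧ ⊗_) (⟦⟧-^ n))
    (trans (⟦⟧-*-homo (+ 2) (+ (2 ^ n))) (cong ⟦_⟧ (sym (ℤ.pos-* 2 (2 ^ n)))))

  ⟦⟧-cancel : ∀ n .{{_ : ℤ.NonZero n}} {x y} → ⟦ n ⟧ ⊗ x ≡ ⟦ n ⟧ ⊗ y → x ≡ y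
  ⟦⟧-cancel n {x} {y} e = cong₂ _+_ω
    (ℤ.*-cancelˡ-≡ n _ _ (cong Quad.re e′)) (ℤ.*-cancelˡ-≡ n _ _ (cong Quad.im e′))
    where
    e′ = trans (sym (⟦⟧-⊗ n x)) (trans e (⟦⟧-⊗ n y))

  -- Multiplying by the conjugate of a replaces a by the integer N(a), which cancels in each
  -- coordinate.
  ⊗-cancelˡ : ∀ a .{{_ : ℤ.NonZero (norm a)}} {x y} → a ⊗ x ≡ a ⊗ y → x ≡ y
  ⊗-cancelˡ a {x} {y} e = ⟦⟧-cancel (norm a) {x} {y}
    (trans (regroup x) (trans (cong (conj a ⊗_) e) (sym (regroup y))))
    where
    regroup : ∀ z → ⟦ norm a ⟧ ⊗ z ≡ conj a ⊗ (a ⊗ z)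
    regroup z = trans (cong (_⊗ z) (trans (sym (conj-norm a)) (*-comm a (conj a)))) (*-assoc (conj a) a z)

  -- The image of I under conjugation, encoded as a preimage; the two agree because conjugation is
  -- an involution.
  conjugate : Ideal → Ideal
  conjugate I = record
    { member    = λ x → conj x ∈ member I
    ; respects  = λ { refl h → h }
    ; 0#-closed = 0#-closed I
    ; +-closed  = λ {x} {y} p q → respects I (sym (conj-⊕ x y)) (+-closed I p q)
    ; *-closed  = λ r {x} p → respects I (sym (conj-⊗ r x)) (*-closed I (conj r) p)
    }

  conj-^ : ∀ {I J} → (∀ {x} → x ∈ member I → conj x ∈ member J) →
           ∀ n {x} → x ∈ member (I ^ᴵ n) → conj x ∈ member (J ^ᴵ n)
  conj-^ {I} {J} I→J zero    x∈ = _
  conj-^ {I} {J} I→J (suc n) x∈ = ·-least {I} {I ^ᴵ n} (conjugate (J ^ᴵ suc n))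
    (λ {x} {y} p q → respects (J ^ᴵ suc n) (sym (conj-⊗ x y)) (·-intro (I→J p) (conj-^ {I} {J} I→J n q))) x∈

  conj-∈-conjugate : ∀ {I x} → x ∈ member I → conj x ∈ member (conjugate I)
  conj-∈-conjugate {I} {x} = respects I (sym (conj-involutive x))

  1≢0 : ¬ (1# ≡ 0#)
  1≢0 ()

  norm-scale : ∀ t x → norm (⟦ t ⟧ ⊗ x) ≡ t ℤ.* (t ℤ.* norm x)
  norm-scale t x@(a + b ω) = trans (cong norm (⟦⟧-⊗ t x)) (eq c t a b)
    where
    eq : ∀ c t a b → t ℤ.* a ℤ.* (t ℤ.* a) ℤ.+ t ℤ.* a ℤ.* (t ℤ.* b) ℤ.+ c ℤ.* (t ℤ.* b ℤ.* (t ℤ.* b)) ≡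
                     t ℤ.* (t ℤ.* (a ℤ.* a ℤ.+ a ℤ.* b ℤ.+ c ℤ.* (b ℤ.* b)))
    eq = solve-∀

  module PositiveDefinite (p : ℕ) (4c≡1+p : + 4 ℤ.* c ≡ + suc p) (0<p : 0 < p) where

    -- Completing the square, with 4c - 1 = p. The absolute values move the form to ℕ, where the
    -- descent takes place.
    four-norm : ∀ a b → + 4 ℤ.* norm (a + b ω) ≡
                + (∣ + 2 ℤ.* a ℤ.+ b ∣ * ∣ + 2 ℤ.* a ℤ.+ b ∣ + p * (∣ b ∣ * ∣ b ∣))
    four-norm a b = begin
      + 4 ℤ.* norm (a + b ω)                       ≡⟨ eq c a b ⟩
      d ℤ.* d ℤ.+ (+ 4 ℤ.* c ℤ.- 1ℤ) ℤ.* (b ℤ.* b) ≡⟨ cong (λ z → d ℤ.* d ℤ.+ (z ℤ.- 1ℤ) ℤ.* (b ℤ.* b)) 4c≡1+p ⟩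
      d ℤ.* d ℤ.+ + p ℤ.* (b ℤ.* b)                ≡⟨ cong₂ (λ x y → x ℤ.+ + p ℤ.* y) (square d) (square b) ⟨
      + (∣ d ∣ * ∣ d ∣) ℤ.+ + p ℤ.* + (∣ b ∣ * ∣ b ∣) ≡⟨ cong (λ z → + (∣ d ∣ * ∣ d ∣) ℤ.+ z) (ℤ.pos-* p _) ⟨
      + (∣ d ∣ * ∣ d ∣ + p * (∣ b ∣ * ∣ b ∣))       ∎
      where
      open ≡-Reasoning
      d : ℤ
      d = + 2 ℤ.* a ℤ.+ b
      eq : ∀ c a b → + 4 ℤ.* (a ℤ.* a ℤ.+ a ℤ.* b ℤ.+ c ℤ.* (b ℤ.* b)) ≡
           (+ 2 ℤ.* a ℤ.+ b) ℤ.* (+ 2 ℤ.* a ℤ.+ b) ℤ.+ (+ 4 ℤ.* c ℤ.- 1ℤ) ℤ.* (b ℤ.* b)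
      eq = solve-∀
      square : ∀ i → + (∣ i ∣ * ∣ i ∣) ≡ i ℤ.* i
      square (+ n)        = ℤ.pos-* n n
      square (ℤ.-[1+ n ]) = refl

    norm≡0⇒≡0 : ∀ x → norm x ≡ 0ℤ → x ≡ 0#
    norm≡0⇒≡0 (a + b ω) e = cong₂ _+_ω a≡0 b≡0
      where
      sum≡0 : ∣ + 2 ℤ.* a ℤ.+ b ∣ * ∣ + 2 ℤ.* a ℤ.+ b ∣ + p * (∣ b ∣ * ∣ b ∣) ≡ 0
      sum≡0 = ℤ.+-injective (trans (sym (four-norm a b)) (cong (+ 4 ℤ.*_) e))
      instance
        p≢0 : ℕ.NonZero p
        p≢0 = ℕ.>-nonZero 0<p
      root : ∀ n → n * n ≡ 0 → n ≡ 0
      root zero _ = refl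
      b≡0 : b ≡ 0ℤ
      b≡0 = ℤ.∣i∣≡0⇒i≡0 (root ∣ b ∣
        (ℕ.*-cancelˡ-≡ _ 0 p (trans (ℕ.m+n≡0⇒n≡0 (∣ + 2 ℤ.* a ℤ.+ b ∣ * ∣ + 2 ℤ.* a ℤ.+ b ∣) sum≡0) (sym (ℕ.*-zeroʳ p)))))
      a≡0 : a ≡ 0ℤ
      a≡0 = ℤ.*-cancelˡ-≡ (+ 2) a 0ℤ (trans (sym (ℤ.+-identityʳ _))
        (trans (cong (λ z → + 2 ℤ.* a ℤ.+ z) (sym b≡0)) (ℤ.∣i∣≡0⇒i≡0 (root _ (ℕ.m+n≡0⇒m≡0 _ sum≡0)))))

    norm-nonZero : ∀ {x} → ¬ (x ≡ 0#) → ℤ.NonZero (norm x)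
    norm-nonZero {x} x≢0 = ℤ.≢-nonZero (x≢0 ∘ norm≡0⇒≡0 x)

    ≢0-cancelˡ : ∀ {a x y} → ¬ (a ≡ 0#) → a ⊗ x ≡ a ⊗ y → x ≡ y
    ≢0-cancelˡ {a} a≢0 = ⊗-cancelˡ a {{norm-nonZero a≢0}}

    -- The conjugate of a generator of Iⁿ generates Jⁿ. Stating this for any two ideals exchanged by
    -- conjugation allows its use in both directions in `conjugate-class-order`.
    conj-trivial : ∀ {I J} → (∀ {x} → x ∈ member I → conj x ∈ member J) →
                   (∀ {x} → x ∈ member J → conj x ∈ member I) →
                   ∀ n → I ^ᴵ n ∼ unitIdeal → J ^ᴵ n ∼ unitIdeal
    conj-trivial {I} {J} I→J J→I n I^n∼1 =
      let (α , α≢0 , α∈ , I⊆α) = trivial⇒generated ≢0-cancelˡ I^n∼1 in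
      generated⇒trivial 1≢0
        (λ e → α≢0 (trans (sym (conj-involutive α)) (cong conj e)))
        (conj-^ {I} {J} I→J n α∈)
        (λ {z} z∈ → let (s , e) = I⊆α (conj-^ {J} {I} J→I n z∈) in
          conj s , trans (sym (conj-involutive z)) (trans (cong conj e) (conj-⊗ s α)))

    -- Cancelling α in αᾱ = s 2ᵏ = s δ α leaves ᾱ = t δ with t = s an integer, and then t divides
    -- both b and 2ᵏ = t N(δ).
    primitive-norm : ∀ k {a b} s δ → let α = a + b ω in ¬ α ≡ 0# → Odd b →
      α ⊗ conj α ≡ s ⊗ ⟦ + (2 ^ k) ⟧ → ⟦ + (2 ^ k) ⟧ ≡ δ ⊗ α → ∣ norm α ∣ ≡ 2 ^ k
    primitive-norm k {a} {b} s δ α≢0 odd-b αᾱ≡ 2^k≡ = begin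
      ∣ norm α ∣     ≡⟨ cong ∣_∣ norm≡ ⟩
      ∣ t ℤ.* + N ∣  ≡⟨ ℤ.abs-* t (+ N) ⟩
      ∣ t ∣ * N      ≡⟨ cong (_* N) ∣t∣≡1 ⟩
      1 * N          ≡⟨ ℕ.*-identityˡ N ⟩
      N              ∎
      where
      open ≡-Reasoning
      N : ℕ
      N = 2 ^ k
      α : Quad c
      α = a + b ω
      t : ℤ
      t = Quad.re s
      instance
        norm≢0 : ℤ.NonZero (norm α)
        norm≢0 = norm-nonZero α≢0
      -- The real parts of αᾱ = s 2ᵏ suffice, since αᾱ is the integer N(α).
      norm≡ : norm α ≡ t ℤ.* + N
      norm≡ = trans (cong Quad.re (trans (sym (conj-norm α)) (trans αᾱ≡
                (trans (*-comm s ⟦ + N ⟧) (⟦⟧-⊗ (+ N) s)))))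
                (ℤ.*-comm (+ N) t)
      conj≡ : conj α ≡ ⟦ t ⟧ ⊗ δ
      conj≡ = ⊗-cancelˡ α (begin
        α ⊗ conj α            ≡⟨ conj-norm α ⟩
        ⟦ norm α ⟧            ≡⟨ cong ⟦_⟧ norm≡ ⟩
        ⟦ t ℤ.* + N ⟧         ≡⟨ ⟦⟧-*-homo t (+ N) ⟨
        ⟦ t ⟧ ⊗ ⟦ + N ⟧       ≡⟨ cong (⟦ t ⟧ ⊗_) 2^k≡ ⟩
        ⟦ t ⟧ ⊗ (δ ⊗ α)       ≡⟨ *-assoc ⟦ t ⟧ δ α ⟨
        ⟦ t ⟧ ⊗ δ ⊗ α         ≡⟨ *-comm (⟦ t ⟧ ⊗ δ) α ⟩
        α ⊗ (⟦ t ⟧ ⊗ δ)       ∎)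
      instance
        t≢0 : ℤ.NonZero t
        t≢0 = ℤ.≢-nonZero {t} λ t≡0 → α≢0 (norm≡0⇒≡0 α (trans norm≡ (cong (ℤ._* + N) {t} {0ℤ} t≡0)))
      N≡ : + N ≡ t ℤ.* norm δ
      N≡ = ℤ.*-cancelˡ-≡ t _ _ (begin
        t ℤ.* + N                ≡⟨ norm≡ ⟨
        norm α                   ≡⟨ norm-conj α ⟨
        norm (conj α)            ≡⟨ cong norm conj≡ ⟩
        norm (⟦ t ⟧ ⊗ δ)         ≡⟨ norm-scale t δ ⟩
        t ℤ.* (t ℤ.* norm δ)     ∎)
      t∣N : ∣ t ∣ ∣ N
      t∣N = divides ∣ norm δ ∣ (trans (cong ∣_∣ N≡) (trans (ℤ.abs-* t (norm δ)) (ℕ.*-comm ∣ t ∣ _)))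
      t∣b : ∣ t ∣ ∣ ∣ b ∣
      t∣b = divides ∣ Quad.im δ ∣ (trans (sym (ℤ.∣-i∣≡∣i∣ b))
        (trans (cong (λ z → ∣ Quad.im z ∣) (trans conj≡ (⟦⟧-⊗ t δ)))
          (trans (ℤ.abs-* t (Quad.im δ)) (ℕ.*-comm ∣ t ∣ _))))
      ∣t∣≡1 : ∣ t ∣ ≡ 1
      ∣t∣≡1 = odd-divisor-2^ k (λ 2∣t → odd⇒2∤∣∣ {b} odd-b (∣-trans 2∣t t∣b)) t∣N

    -- With c even, ω (1 - ω) = c lies in every ideal containing 2, so a prime ideal above 2
    -- contains ω or its conjugate 1 - ω.
    module PrimeAboveTwo (c-even : Even c) (P : Ideal) (1∉P : ¬ 1# ∈ member P)
                    (2∈P : ⟦ + 2 ⟧ ∈ member P) (ω∈P : (0ℤ + 1ℤ ω) ∈ member P) where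

      Q : Ideal
      Q = conjugate P

      -- Together with `∈P⇒even`, this describes P as the set of all a + b ω with a even. An odd a
      -- would put 1 into P.
      even⇒∈P : ∀ {a b} → Even a → (a + b ω) ∈ member P
      even⇒∈P {a} {b} (k , refl) = respects P (cong₂ _+_ω (eq₁ c k b) (eq₂ k b))
        (+-closed P (*-closed P ⟦ k ⟧ 2∈P) (*-closed P ⟦ b ⟧ ω∈P))
        where
        eq₁ : ∀ c k b → k ℤ.* + 2 ℤ.- c ℤ.* (0ℤ ℤ.* 0ℤ) ℤ.+ (b ℤ.* 0ℤ ℤ.- c ℤ.* (0ℤ ℤ.* 1ℤ)) ≡ k ℤ.* + 2
        eq₁ = solve-∀
        eq₂ : ∀ k b → k ℤ.* 0ℤ ℤ.+ 0ℤ ℤ.* + 2 ℤ.+ 0ℤ ℤ.* 0ℤ ℤ.+ (b ℤ.* 1ℤ ℤ.+ 0ℤ ℤ.* 0ℤ ℤ.+ 0ℤ ℤ.* 1ℤ) ≡ b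
        eq₂ = solve-∀

      ∈P⇒even : ∀ {a b} → (a + b ω) ∈ member P → Even a
      ∈P⇒even {a} {b} x∈ with even⊎odd a
      ... | inj₁ e = e
      ... | inj₂ o = ⊥-elim (1∉P (respects P (cong₂ _+_ω (eq₁ a) (eq₂ b))
                       (+-closed P (even⇒∈P {1ℤ ℤ.- a} {ℤ.- b} o) x∈)))
        where
        eq₁ : ∀ a → 1ℤ ℤ.- a ℤ.+ a ≡ 1ℤ
        eq₁ = solve-∀
        eq₂ : ∀ b → ℤ.- b ℤ.+ b ≡ 0ℤ
        eq₂ = solve-∀

      -- For y = d + e ω, membership in Q says that d + e is even. Then ad - cbe is even because a
      -- and c are, and ae + b(d + e) because a and d + e are.
      PQ⊆2 : ∀ {x y} → x ∈ member P → y ∈ member Q → x ⊗ y ∈ member (principal ⟦ + 2 ⟧)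
      PQ⊆2 {a + b ω} {d + e ω} x∈ y∈
        with ∈P⇒even {a} {b} x∈ | ∈P⇒even {d ℤ.+ e} {ℤ.- e} y∈
      ... | k , refl | l , 2l≡d+e =
        s ,
        trans (cong₂ _+_ω (trans (cong (λ z → k ℤ.* + 2 ℤ.* d ℤ.- z ℤ.* (b ℤ.* e)) (sym 2m≡c)) (eq₁ k m b d e)) (trans (eq₂ k b d e)
                (trans (cong (λ z → k ℤ.* e ℤ.* + 2 ℤ.+ b ℤ.* z) (sym 2l≡d+e)) (eq₃ k b e l))))
          (sym (trans (*-comm s ⟦ + 2 ⟧) (⟦⟧-⊗ (+ 2) s)))
        where
        s : Quad c
        s = (k ℤ.* d ℤ.- proj₁ c-even ℤ.* (b ℤ.* e)) + (k ℤ.* e ℤ.+ b ℤ.* l) ω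
        m = proj₁ c-even
        2m≡c = proj₂ c-even
        eq₁ : ∀ k m b d e → k ℤ.* + 2 ℤ.* d ℤ.- m ℤ.* + 2 ℤ.* (b ℤ.* e) ≡ + 2 ℤ.* (k ℤ.* d ℤ.- m ℤ.* (b ℤ.* e))
        eq₁ = solve-∀
        eq₂ : ∀ k b d e → k ℤ.* + 2 ℤ.* e ℤ.+ b ℤ.* d ℤ.+ b ℤ.* e ≡ k ℤ.* e ℤ.* + 2 ℤ.+ b ℤ.* (d ℤ.+ e)
        eq₂ = solve-∀
        eq₃ : ∀ k b e l → k ℤ.* e ℤ.* + 2 ℤ.+ b ℤ.* (l ℤ.* + 2) ≡ + 2 ℤ.* (k ℤ.* e ℤ.+ b ℤ.* l)
        eq₃ = solve-∀

      2^∈P^ : ∀ n → ⟦ + (2 ^ n) ⟧ ∈ member (P ^ᴵ n)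
      2^∈P^ n = respects (P ^ᴵ n) (⟦⟧-^ n) (^-intro {P} n 2∈P)

      P^Q^⊆2^ : ∀ n {x y} → x ∈ member (P ^ᴵ n) → y ∈ member (Q ^ᴵ n) →
                ∃ λ s → x ⊗ y ≡ s ⊗ ⟦ + (2 ^ n) ⟧
      P^Q^⊆2^ n {x} {y} x∈ y∈ = let (s , e) = ^-product-⊆ {P} {Q} (λ {x} {y} → PQ⊆2 {x} {y}) n {x} {y} x∈ y∈ in
        s , trans e (cong (s ⊗_) (⟦⟧-^ n))

      conj-∈Q^ : ∀ n {x} → x ∈ member (P ^ᴵ n) → conj x ∈ member (Q ^ᴵ n)
      conj-∈Q^ n {x} = conj-^ {P} {Q} (λ {y} → conj-∈-conjugate {P} {y}) n {x}

      -- The conjugate of 1 - ω is ω ∈ P, so 1 - ω ∈ Q and ω ≡ 1 modulo Q. Factors ω can thus be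
      -- removed until 1 ∈ Q is reached, which is absurd.
      ω^∉Q : ∀ n → ¬ (0ℤ + 1ℤ ω) Exp.^ n ∈ member Q
      ω^∉Q zero    1∈Q = 1∉P 1∈Q
      ω^∉Q (suc n) h = ω^∉Q n (·⊆ˡ {Q} {unitIdeal} {x} (^-cancel-unit {Q} {1ℤ + (ℤ.- 1ℤ) ω} {0ℤ + 1ℤ ω} {x} 1
        ω∈P refl (respects (Q ^ᴵ 1) {x = y ⊗ 1#} {y = y} (*-identityʳ y) (·-intro {Q} {unitIdeal} {y} {1#} h tt))))
        where
        x y : Quad c
        x = (0ℤ + 1ℤ ω) Exp.^ n
        y = (0ℤ + 1ℤ ω) Exp.^ suc n

      -- A power of ω lies in P^(n+1), hence is a multiple of α, but it is not in Q. So α ∉ Q, that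
      -- is, a + b is odd; as α ∈ P makes a even, b is odd and `primitive-norm` applies.
      generator⇒norm-form : ∀ n {a b} → let α = a + b ω in
        ¬ α ≡ 0# → α ∈ member (P ^ᴵ suc n) →
        (∀ {z} → z ∈ member (P ^ᴵ suc n) → z ∈ member (principal α)) →
        ∃₂ λ X Y → ¬ (2 ∣ X) × ¬ (2 ∣ Y) × X * X + p * (Y * Y) ≡ 4 * 2 ^ suc n
      generator⇒norm-form n {a} {b} α≢0 α∈ P^⊆α =
        ∣ + 2 ℤ.* a ℤ.+ b ∣ , ∣ b ∣ , odd⇒2∤∣∣ {+ 2 ℤ.* a ℤ.+ b} odd-2a+b , odd⇒2∤∣∣ {b} odd-b , (begin
          ∣ + 2 ℤ.* a ℤ.+ b ∣ * ∣ + 2 ℤ.* a ℤ.+ b ∣ + p * (∣ b ∣ * ∣ b ∣) ≡⟨ cong ∣_∣ (four-norm a b) ⟨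
          ∣ + 4 ℤ.* norm α ∣     ≡⟨ ℤ.abs-* (+ 4) (norm α) ⟩
          4 * ∣ norm α ∣         ≡⟨ cong (4 *_) (primitive-norm (suc n) (proj₁ product) (proj₁ generated) α≢0 odd-b (proj₂ product) (proj₂ generated)) ⟩
          4 * 2 ^ suc n          ∎)
        where
        open ≡-Reasoning
        α : Quad c
        α = a + b ω
        product = P^Q^⊆2^ (suc n) {α} {conj α} α∈ (conj-∈Q^ (suc n) {α} α∈)
        generated = P^⊆α (2^∈P^ (suc n))
        even-a : Even a
        even-a = ∈P⇒even {a} {b} (·⊆ˡ {P} {P ^ᴵ n} {α} α∈)
        α∉Q : ¬ α ∈ member Q
        α∉Q α∈Q = let (s , e) = P^⊆α (^-intro {P} (suc n) ω∈P) in
          ω^∉Q (suc n) (respects Q {x = s ⊗ α} {y = (0ℤ + 1ℤ ω) Exp.^ suc n} (sym e) (*-closed Q s {α} α∈Q))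
        odd-b : Odd b
        odd-b with even⊎odd (a ℤ.+ b)
        ... | inj₁ e = ⊥-elim (α∉Q (even⇒∈P {a ℤ.+ b} {ℤ.- b} e))
        ... | inj₂ o = subst Even (eq a b) (even+ even-a o)
          where
          eq : ∀ a b → a ℤ.+ (1ℤ ℤ.- (a ℤ.+ b)) ≡ 1ℤ ℤ.- b
          eq = solve-∀
        odd-2a+b : Odd (+ 2 ℤ.* a ℤ.+ b)
        odd-2a+b = subst Even (eq a b) (even+ odd-b (ℤ.- a , refl))
          where
          eq : ∀ a b → (1ℤ ℤ.- b) ℤ.+ ℤ.- a ℤ.* + 2 ≡ 1ℤ ℤ.- (+ 2 ℤ.* a ℤ.+ b)
          eq = solve-∀

      trivial⇒norm-form : ∀ n → P ^ᴵ suc n ∼ unitIdeal →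
        ∃₂ λ X Y → ¬ (2 ∣ X) × ¬ (2 ∣ Y) × X * X + p * (Y * Y) ≡ 4 * 2 ^ suc n
      trivial⇒norm-form n P^∼1 =
        let (_ , α≢0 , α∈ , P^⊆α) = trivial⇒generated ≢0-cancelˡ {P ^ᴵ suc n} P^∼1 in
        generator⇒norm-form n α≢0 α∈ P^⊆α

      -- Since a + b is odd, β̄ ≡ 1 modulo P, and β̄β = 2ᵐ ∈ Pᵐ yields β ∈ Pᵐ. For z ∈ Pᵐ, zβ̄ is a
      -- multiple of 2ᵐ = ββ̄, and cancelling β̄ shows z ∈ (β).
      generates-P^ : ∀ m {a b} → Even a → Odd (a ℤ.+ b) → norm (a + b ω) ≡ + (2 ^ m) →
                     P ^ᴵ m ∼ unitIdeal
      generates-P^ m {a} {b} a-even a+b-odd norm≡ = generated⇒trivial {P ^ᴵ m} {β} 1≢0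
        (λ β≡0 → norm-β≢0 (cong norm β≡0)) β∈
        λ {z} z∈ → let (s , e) = P^Q^⊆2^ m {z} {conj β} z∈ (conj-∈Q^ m {β} β∈) in
          s , ⊗-cancelˡ (conj β) {{norm-conj≢0}} {z} {s ⊗ β} (begin
            conj β ⊗ z          ≡⟨ *-comm (conj β) z ⟩
            z ⊗ conj β          ≡⟨ e ⟩
            s ⊗ ⟦ + (2 ^ m) ⟧   ≡⟨ cong (s ⊗_) ββ̄≡ ⟨
            s ⊗ (β ⊗ conj β)    ≡⟨ *-assoc s β (conj β) ⟨
            s ⊗ β ⊗ conj β      ≡⟨ *-comm (s ⊗ β) (conj β) ⟩
            conj β ⊗ (s ⊗ β)    ∎)
        where
        open ≡-Reasoning
        β : Quad c
        β = a + b ω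
        ββ̄≡ : β ⊗ conj β ≡ ⟦ + (2 ^ m) ⟧
        ββ̄≡ = trans (conj-norm β) (cong ⟦_⟧ norm≡)
        norm-β≢0 : ¬ norm β ≡ norm 0#
        norm-β≢0 e = ℕ.≢-nonZero⁻¹ (2 ^ m) {{ℕ.m^n≢0 2 m}} (ℤ.+-injective (trans (sym norm≡) (trans e (eq c))))
          where
          eq : ∀ c → 0ℤ ℤ.* 0ℤ ℤ.+ 0ℤ ℤ.* 0ℤ ℤ.+ c ℤ.* (0ℤ ℤ.* 0ℤ) ≡ 0ℤ
          eq = solve-∀
        norm-conj≢0 : ℤ.NonZero (norm (conj β))
        norm-conj≢0 = subst ℤ.NonZero (sym (trans (norm-conj β) norm≡)) (ℕ.m^n≢0 2 m)
        β∈ : β ∈ member (P ^ᴵ m)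
        β∈ = ^-cancel-unit {P} {(1ℤ ℤ.- (a ℤ.+ b)) + b ω} {conj β} {β} m (even⇒∈P {_} {b} a+b-odd)
          (cong₂ _+_ω (eq₁ (a ℤ.+ b)) (ℤ.+-inverseʳ b))
          (respects (P ^ᴵ m) {⟦ + (2 ^ m) ⟧} {conj β ⊗ β} (trans (sym ββ̄≡) (*-comm β (conj β))) (2^∈P^ m))
          where
          eq₁ : ∀ a → 1ℤ ℤ.- a ℤ.+ a ≡ 1ℤ
          eq₁ = solve-∀

      -- As b is odd, exactly one of a and a + b is even. Conjugation exchanges the two and keeps
      -- the norm, so either a + b ω or its conjugate generates.
      norm-form⇒trivial : ∀ m {a b} → Odd b → norm (a + b ω) ≡ + (2 ^ m) → P ^ᴵ m ∼ unitIdeal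
      norm-form⇒trivial m {a} {b} b-odd norm≡ with even⊎odd a
      ... | inj₁ a-even = generates-P^ m {a} {b} a-even
            (subst Even (eq a b) (even+ b-odd (even- a-even))) norm≡
        where
        eq : ∀ a b → 1ℤ ℤ.- b ℤ.+ ℤ.- a ≡ 1ℤ ℤ.- (a ℤ.+ b)
        eq = solve-∀
      ... | inj₂ a-odd = generates-P^ m {a ℤ.+ b} {ℤ.- b}
            (subst Even (eq₁ a b) (even+ (1ℤ , refl) (even- (even+ a-odd b-odd))))
            (subst Odd (eq₂ a b) a-odd) (trans (norm-conj (a + b ω)) norm≡)
        where
        eq₁ : ∀ a b → + 2 ℤ.+ ℤ.- (1ℤ ℤ.- a ℤ.+ (1ℤ ℤ.- b)) ≡ a ℤ.+ b
        eq₁ = solve-∀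
        eq₂ : ∀ a b → a ≡ a ℤ.+ b ℤ.+ ℤ.- b
        eq₂ = solve-∀

-- Descent for X² + p Y² = 4 · 2ⁿ

-- The root of a is g = gcd(a, y). With a = a′g and y = y′g the equation becomes a′b = y′²g; a′ is
-- coprime to y′, so a′ divides g, and g is coprime to b, so g divides a′.
coprime-factors-of-square : ∀ {a b y} .{{_ : NonZero y}} → Coprime a b → a * b ≡ y * y →
                            ∃₂ λ u v → a ≡ u * u × b ≡ v * v × u * v ≡ y
coprime-factors-of-square {a} {b} {y} a⊥b ab≡yy = g , y′ , a≡gg , b≡y′y′ , trans (ℕ.*-comm g y′) y′g≡y
  where
  g : ℕ
  g = gcd a y
  instance
    g≢0 : NonZero g
    g≢0 = ℕ.≢-nonZero (gcd[m,n]≢0 a y (inj₂ (ℕ.≢-nonZero⁻¹ y)))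
  a′ y′ : ℕ
  a′ = a / g
  y′ = y / g
  a′g≡a : a′ * g ≡ a
  a′g≡a = m/n*n≡m (gcd[m,n]∣m a y)
  y′g≡y : y′ * g ≡ y
  y′g≡y = m/n*n≡m (gcd[m,n]∣n a y)
  a′⊥y′ : Coprime a′ y′
  a′⊥y′ = coprime-/gcd a y
  open ≡-Reasoning
  a′b≡ : a′ * b ≡ y′ * (y′ * g)
  a′b≡ = ℕ.*-cancelʳ-≡ _ _ g (begin
    a′ * b * g            ≡⟨ eq₁ a′ b g ⟩
    a′ * g * b            ≡⟨ cong (_* b) a′g≡a ⟩
    a * b                 ≡⟨ ab≡yy ⟩
    y * y                 ≡⟨ cong₂ _*_ y′g≡y y′g≡y ⟨
    y′ * g * (y′ * g)     ≡⟨ eq₂ y′ g ⟩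
    y′ * (y′ * g) * g     ∎)
    where
    eq₁ : ∀ a b g → a * b * g ≡ a * g * b
    eq₁ = ℕ-Solver.solve-∀
    eq₂ : ∀ y g → y * g * (y * g) ≡ y * (y * g) * g
    eq₂ = ℕ-Solver.solve-∀
  a′∣g : a′ ∣ g
  a′∣g = coprime-divisor a′⊥y′ (coprime-divisor a′⊥y′ (subst (a′ ∣_) a′b≡ (m∣m*n b)))
  g∣a′ : g ∣ a′
  g∣a′ = coprime-divisor {n = b} (λ (d∣g , d∣b) → a⊥b (∣-trans d∣g (gcd[m,n]∣m a y) , d∣b))
    (subst (g ∣_) (trans (sym a′b≡) (ℕ.*-comm a′ b)) (∣n⇒∣m*n y′ (n∣m*n y′)))
  a′≡g : a′ ≡ g
  a′≡g = ∣-antisym a′∣g g∣a′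
  a≡gg : a ≡ g * g
  a≡gg = trans (sym a′g≡a) (cong (_* g) a′≡g)
  b≡y′y′ : b ≡ y′ * y′
  b≡y′y′ = ℕ.*-cancelˡ-≡ _ _ g (begin
    g * b           ≡⟨ cong (_* b) a′≡g ⟨
    a′ * b          ≡⟨ a′b≡ ⟩
    y′ * (y′ * g)   ≡⟨ eq y′ g ⟩
    g * (y′ * y′)   ∎)
    where
    eq : ∀ y g → y * (y * g) ≡ g * (y * y)
    eq = ℕ-Solver.solve-∀

coprime-factors-of-prime*square : ∀ {p a b y} .{{_ : NonZero y}} → Prime p → p ∣ a → Coprime a b →
  a * b ≡ p * (y * y) → ∃₂ λ u v → a ≡ p * (u * u) × b ≡ v * v × u * v ≡ y
coprime-factors-of-prime*square {p} {_} {b} {y} p-prime (divides a refl) ap⊥b e =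
  let (u , v , a≡ , b≡ , uv≡) = coprime-factors-of-square
        (λ (d∣a , d∣b) → ap⊥b (∣m⇒∣m*n p d∣a , d∣b))
        (ℕ.*-cancelˡ-≡ (a * b) (y * y) p {{prime⇒nonZero p-prime}} (trans (eq p a b) e))
  in u , v , trans (ℕ.*-comm a p) (cong (p *_) a≡) , b≡ , uv≡
  where
  eq : ∀ p a b → p * (a * b) ≡ a * p * b
  eq = ℕ-Solver.solve-∀

-- In T² - X² = p Y² the two factors T ± X are coprime, so they are p u² and v².
norm-form-descent : ∀ {p} m {X Y} → Prime p → ¬ (2 ∣ X) → ¬ (2 ∣ Y) →
  X * X + p * (Y * Y) ≡ 4 * 2 ^ (m + m) →
  ∃₂ λ v u → ¬ (2 ∣ v) × ¬ (2 ∣ u) × v * v + p * (u * u) ≡ 4 * 2 ^ m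
norm-form-descent {p} m {X} {Y} p-prime 2∤X 2∤Y form = conclude
  where
  T A B : ℕ
  T = 2 * 2 ^ m
  B = T ∸ X
  A = X + T
  open ≡-Reasoning
  instance
    Y≢0 : NonZero Y
    Y≢0 = ℕ.≢-nonZero λ { refl → 2∤Y (divides 0 refl) }
    p≢0 : NonZero p
    p≢0 = prime⇒nonZero p-prime
  form′ : X * X + p * (Y * Y) ≡ T * T
  form′ = begin
    X * X + p * (Y * Y)     ≡⟨ form ⟩
    4 * 2 ^ (m + m)         ≡⟨ cong (4 *_) (ℕ.^-distribˡ-+-* 2 m m) ⟩
    4 * (2 ^ m * 2 ^ m)     ≡⟨ eq (2 ^ m) ⟩
    T * T                   ∎
    where
    eq : ∀ t → 4 * (t * t) ≡ 2 * t * (2 * t)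
    eq = ℕ-Solver.solve-∀
  -- As p Y² > 0, X stays below T and the truncated difference `B` is the true one.
  X<T : X < T
  X<T = ℕ.≰⇒> λ T≤X → ℕ.<-irrefl (sym form′) (ℕ.≤-<-trans (ℕ.*-mono-≤ T≤X T≤X)
    (ℕ.m<m+n (X * X) (ℕ.>-nonZero⁻¹ _ {{ℕ.m*n≢0 p (Y * Y) {{p≢0}} {{ℕ.m*n≢0 Y Y}}}})))
  X+B≡T : X + B ≡ T
  X+B≡T = ℕ.m+[n∸m]≡n (ℕ.<⇒≤ X<T)
  AB≡ : A * B ≡ p * (Y * Y)
  AB≡ = ℕ.+-cancelˡ-≡ (X * X) _ _ (begin
    X * X + (X + T) * B            ≡⟨ cong (λ t → X * X + (X + t) * B) X+B≡T ⟨
    X * X + (X + (X + B)) * B      ≡⟨ eq X B ⟩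
    (X + B) * (X + B)              ≡⟨ cong₂ _*_ X+B≡T X+B≡T ⟩
    T * T                          ≡⟨ form′ ⟨
    X * X + p * (Y * Y)            ∎)
    where
    eq : ∀ x b → x * x + (x + (x + b)) * b ≡ (x + b) * (x + b)
    eq = ℕ-Solver.solve-∀
  A+B≡ : A + B ≡ 4 * 2 ^ m
  A+B≡ = begin
    X + T + B     ≡⟨ eq X T B ⟩
    T + (X + B)   ≡⟨ cong (λ x → T + x) X+B≡T ⟩
    T + T         ≡⟨ eq′ (2 ^ m) ⟩
    4 * 2 ^ m     ∎
    where
    eq : ∀ x t b → x + t + b ≡ t + (x + b)
    eq = ℕ-Solver.solve-∀
    eq′ : ∀ t → 2 * t + 2 * t ≡ 4 * t
    eq′ = ℕ-Solver.solve-∀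
  2∤B : ¬ (2 ∣ B)
  2∤B 2∣B = 2∤X (∣m+n∣m⇒∣n (subst (2 ∣_) (trans (sym X+B≡T) (ℕ.+-comm X B)) (m∣m*n (2 ^ m))) 2∣B)
  -- A common divisor divides A + B = 2T, a power of 2, and is odd because B is.
  A⊥B : Coprime A B
  A⊥B {d} (d∣A , d∣B) = odd-divisor-2^ (2 + m) (λ 2∣d → 2∤B (∣-trans 2∣d d∣B))
    (subst (d ∣_) (trans A+B≡ (ℕ.*-assoc 2 2 (2 ^ m))) (∣m∣n⇒∣m+n d∣A d∣B))
  odd : ∀ {u v} → u * v ≡ Y → ¬ (2 ∣ v) × ¬ (2 ∣ u)
  odd {u} {v} uv≡Y = (λ 2∣v → 2∤Y (subst (2 ∣_) uv≡Y (∣n⇒∣m*n u 2∣v))) ,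
                     (λ 2∣u → 2∤Y (subst (2 ∣_) uv≡Y (∣m⇒∣m*n v 2∣u)))
  conclude : ∃₂ λ v u → ¬ (2 ∣ v) × ¬ (2 ∣ u) × v * v + p * (u * u) ≡ 4 * 2 ^ m
  conclude with euclidsLemma A B p-prime (divides (Y * Y) (trans AB≡ (ℕ.*-comm p _)))
  ... | inj₁ p∣A =
    let (u , v , A≡ , B≡ , uv≡Y) = coprime-factors-of-prime*square p-prime p∣A A⊥B AB≡
        (2∤v , 2∤u) = odd uv≡Y in
    v , u , 2∤v , 2∤u , trans (cong₂ _+_ (sym B≡) (sym A≡)) (trans (ℕ.+-comm B A) A+B≡)
  ... | inj₂ p∣B =
    let (u , v , B≡ , A≡ , uv≡Y) = coprime-factors-of-prime*square p-prime p∣B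
                                     (Coprimality.sym A⊥B) (trans (ℕ.*-comm B A) AB≡)
        (2∤v , 2∤u) = odd uv≡Y in
    v , u , 2∤v , 2∤u , trans (cong₂ _+_ (sym A≡) (sym B≡)) A+B≡

norm-form-large : ∀ {p} X {Y} → 8 < p → ¬ (2 ∣ Y) → ¬ X * X + p * (Y * Y) ≡ 8
norm-form-large     X {zero}  8<p 2∤Y _    = 2∤Y (divides 0 refl)
norm-form-large {p} X {suc Y} 8<p _   form = ℕ.<⇒≱ 8<p (ℕ.≤-trans (ℕ.m≤m*n p (suc Y * suc Y))
  (ℕ.≤-trans (ℕ.m≤n+m _ (X * X)) (ℕ.≤-reflexive form)))

-- Parity of the class order

2∤⇒odd : ∀ n → ¬ (2 ∣ n) → Odd (+ n)
2∤⇒odd n 2∤n with even⊎odd (+ n)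
... | inj₁ (k , e) = ⊥-elim (2∤n (divides ∣ k ∣ (trans (cong ∣_∣ (sym e)) (ℤ.abs-* k (+ 2)))))
... | inj₂ o       = o

halve : ∀ n → ∃ λ m → n ≡ m + m ⊎ n ≡ suc (m + m)
halve zero    = 0 , inj₁ refl
halve (suc n) with halve n
... | m , inj₁ e = m , inj₂ (cong suc e)
... | m , inj₂ e = suc m , inj₁ (trans (cong suc e) (cong suc (sym (ℕ.+-suc m m))))

module _ {c : ℤ} {p : ℕ} (p-prime : Prime p) (4c≡1+p : + 4 ℤ.* c ≡ + suc p) (c-even : Even c) (8<p : 8 < p) where

  open CommutativeRing (quadRing c) using (1#)
  open Ideals (quadRing c)
  open Ideal using (respects; *-closed)
  open Quadratic c
  open PositiveDefinite p 4c≡1+p (ℕ.≤-trans (s≤s z≤n) 8<p)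

  module _ (P : Ideal) (1∉P : ¬ 1# ∈ member P) (2∈P : ⟦ + 2 ⟧ ∈ member P)
           (ω∈P : (0ℤ + 1ℤ ω) ∈ member P) where

    open PrimeAboveTwo c-even P 1∉P 2∈P ω∈P

    halve-trivial : ∀ m → P ^ᴵ (suc m + suc m) ∼ unitIdeal → P ^ᴵ suc m ∼ unitIdeal
    halve-trivial m P^∼1 =
      let (_ , _ , 2∤X , 2∤Y , form)  = trivial⇒norm-form (m + suc m) P^∼1
          (v , u , 2∤v , 2∤u , form′) = norm-form-descent (suc m) p-prime 2∤X 2∤Y form
      in conclude v u 2∤v 2∤u form′
      where
      conclude : ∀ v u → ¬ (2 ∣ v) → ¬ (2 ∣ u) → v * v + p * (u * u) ≡ 4 * 2 ^ suc m → P ^ᴵ suc m ∼ unitIdeal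
      -- The element is a + u ω with a = (v - u) / 2, so that 2a + u = v and `four-norm` returns v²
      -- + p u².
      conclude v u 2∤v 2∤u form = norm-form⇒trivial (suc m) {a} {+ u} odd-u
        (ℤ.*-cancelˡ-≡ (+ 4) _ _ (begin
          + 4 ℤ.* norm (a + + u ω)   ≡⟨ four-norm a (+ u) ⟩
          + (∣ + 2 ℤ.* a ℤ.+ + u ∣ * ∣ + 2 ℤ.* a ℤ.+ + u ∣ + p * (u * u)) ≡⟨ cong (λ z → + (∣ z ∣ * ∣ z ∣ + p * (u * u))) 2a+u≡v ⟩
          + (v * v + p * (u * u))    ≡⟨ cong +_ form ⟩
          + (4 * 2 ^ suc m)          ≡⟨ ℤ.pos-* 4 (2 ^ suc m) ⟩
          + 4 ℤ.* + (2 ^ suc m)      ∎))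
        where
        open ≡-Reasoning
        odd-u : Odd (+ u)
        odd-u = 2∤⇒odd u 2∤u
        eq₁ : ∀ u v → 1ℤ ℤ.- u ℤ.+ ℤ.- (1ℤ ℤ.- v) ≡ v ℤ.- u
        eq₁ = solve-∀
        half : Even (+ v ℤ.- + u)
        half = subst Even (eq₁ (+ u) (+ v)) (even+ odd-u (even- (2∤⇒odd v 2∤v)))
        a : ℤ
        a = proj₁ half
        eq₂ : ∀ u v → v ℤ.- u ℤ.+ u ≡ v
        eq₂ = solve-∀
        2a+u≡v : + 2 ℤ.* a ℤ.+ + u ≡ + v
        2a+u≡v = trans (cong (ℤ._+ + u) (trans (ℤ.*-comm (+ 2) a) (proj₂ half))) (eq₂ (+ u) (+ v))

    ¬trivial : ¬ P ^ᴵ 1 ∼ unitIdeal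
    ¬trivial P∼1 = let (X , _ , _ , 2∤Y , form) = trivial⇒norm-form 0 P∼1 in
      norm-form-large X 8<p 2∤Y form

    -- The shape 3 + (k + k) records oddness and the lower bound 3 at once; the diameter will be 3 +
    -- k.
    class-order-odd : ∀ {L} → IsClassOrder P L → ∃ λ k → L ≡ 3 + (k + k)
    class-order-odd {L} ord with halve L
    ... | zero  , inj₁ refl = ⊥-elim (ℕ.<-irrefl refl (IsClassOrder.positive ord))
    ... | suc m , inj₁ refl = ⊥-elim (IsClassOrder.least ord (s≤s z≤n) (ℕ.m<m+n (suc m) (s≤s z≤n))
                                (halve-trivial m (IsClassOrder.trivial ord)))
    ... | zero  , inj₂ refl = ⊥-elim (¬trivial (IsClassOrder.trivial ord))
    ... | suc k , inj₂ refl = k , cong (λ n → suc (suc n)) (ℕ.+-suc k k)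

  conjugate-class-order : ∀ {P L} → IsClassOrder P L → IsClassOrder (conjugate P) L
  conjugate-class-order {P} {L} ord = record
    { positive = positive
    ; trivial  = conj-trivial {P} {conjugate P} (λ {x} → conj-∈-conjugate {P} {x}) (λ h → h) L trivial
    ; least    = λ {m} 0<m m<L t → least 0<m m<L
        (conj-trivial {conjugate P} {P} (λ h → h) (λ {x} → conj-∈-conjugate {P} {x}) m t)
    }
    where
    open IsClassOrder ord

  order-above-2-odd : ∀ {P L} → IsPrime P → ⟦ + 2 ⟧ ∈ member P → IsClassOrder P L → ∃ λ k → L ≡ 3 + (k + k)
  order-above-2-odd {P} P-prime 2∈P ord with IsPrime.split P-prime {0ℤ + 1ℤ ω} {1ℤ + (ℤ.- 1ℤ) ω} ωω̄∈P
    where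
    eq₁ : ∀ c k → k ℤ.* + 2 ℤ.- c ℤ.* (0ℤ ℤ.* 0ℤ) ≡ k ℤ.* + 2
    eq₁ = solve-∀
    eq₂ : ∀ k → k ℤ.* 0ℤ ℤ.+ 0ℤ ℤ.* + 2 ℤ.+ 0ℤ ℤ.* 0ℤ ≡ 0ℤ
    eq₂ = solve-∀
    eq₃ : ∀ c → c ≡ 0ℤ ℤ.* 1ℤ ℤ.- c ℤ.* (1ℤ ℤ.* ℤ.- 1ℤ)
    eq₃ = solve-∀
    ωω̄∈P : ((0ℤ ℤ.* 1ℤ ℤ.- c ℤ.* (1ℤ ℤ.* ℤ.- 1ℤ)) + 0ℤ ω) ∈ member P
    ωω̄∈P = respects P (cong₂ _+_ω (trans (eq₁ c (proj₁ c-even)) (trans (proj₂ c-even) (eq₃ c))) (eq₂ (proj₁ c-even)))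
      (*-closed P ⟦ proj₁ c-even ⟧ 2∈P)
  ... | inj₁ ω∈P = class-order-odd P (IsPrime.proper P-prime) 2∈P ω∈P ord
  -- Here the conjugate ideal contains ω, and it has the same class order.
  ... | inj₂ ω̄∈P = class-order-odd (conjugate P) (IsPrime.proper P-prime) 2∈P ω̄∈P (conjugate-class-order ord)

-- Distances in the stacked component

module Walks {V : Set} {Adj : Rel V 0ℓ} where

  open Graph Adj

  infixr 5 _++_

  _++_ : ∀ {m n u v w} → Walk m u v → Walk n v w → Walk (m + n) u w
  []      ++ q = q
  (e ∷ p) ++ q = e ∷ (p ++ q)

  reverse : Symmetric Adj → ∀ {n u v} → Walk n u v → Walk n v u
  reverse sym-Adj []                  = []
  reverse sym-Adj {suc n} {u} {v} (e ∷ p) =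
    subst (λ k → Walk k v u) (ℕ.+-comm n 1) (reverse sym-Adj p ++ (sym-Adj e ∷ []))

  -- Lower bounds on distances come from here: `h` drops by at most one along each edge.
  lipschitz⇒≤ : (h : V → ℕ) → (∀ {u v} → Adj u v → h u ≤ suc (h v)) →
                ∀ {n u v} → Walk n u v → h u ≤ n + h v
  lipschitz⇒≤ h step []      = ℕ.≤-refl
  lipschitz⇒≤ h step (e ∷ p) = ℕ.≤-trans (step e) (s≤s (lipschitz⇒≤ h step p))

module FiniteWalks {N : ℕ} {Adj : Rel (Fin N) 0ℓ} (adj? : Decidable Adj) where

  open Graph Adj

  walk? : ∀ n u v → Dec (Walk n u v)
  walk? zero u v with u Fin.≟ v
  ... | yes refl = yes []
  ... | no  u≢v  = no λ { [] → u≢v refl }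
  walk? (suc n) u v = Dec.map′ (λ (w , e , p) → e ∷ p) (λ { (e ∷ p) → _ , e , p })
    (Fin.any? λ w → adj? u w ×-dec walk? n w v)

  -- Least-number search over the decidable lengths: d rises from 0 while k = n - d falls, and at d
  -- = n the given walk is itself shortest.
  walk⇒distance : ∀ {n u v} → Walk n u v → ∃ λ d → IsDistance u v d × d ≤ n
  walk⇒distance {n} {u} {v} p = search 0 n (λ _ ()) (ℕ.+-identityʳ n)
    where
    search : ∀ d k → (∀ {m} → Walk m u v → ¬ m < d) → k + d ≡ n → ∃ λ e → IsDistance u v e × e ≤ n
    search d zero    none refl = d , record { walk = p ; shortest = λ r → ℕ.≮⇒≥ (none r) } , ℕ.≤-refl
    search d (suc k) none eq with walk? d u v
    ... | yes r = d , record { walk = r ; shortest = λ r′ → ℕ.≮⇒≥ (none r′) } , subst (d ≤_) eq (ℕ.m≤n+m d (suc k))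
    ... | no ¬r = search (suc d) k none′ (trans (ℕ.+-suc k d) eq)
      where
      none′ : ∀ {m} → Walk m u v → ¬ m < suc d
      none′ r m<1+d with ℕ.m≤n⇒m<n∨m≡n (ℕ.≤-pred m<1+d)
      ... | inj₁ m<d  = none r m<d
      ... | inj₂ refl = ¬r r

module StackedComponent (L : ℕ) where

  open Graph (Stacked L)
  open Walks {Adj = Stacked L}

  edge? : Decidable (Edge L)
  edge? a b = Dec.map′ to from
    (ℕ.anyUpTo? (λ i → (a ℕ.≟ 2 * i) ×-dec (b ℕ.≟ 2 * i + 1)) L
     ⊎-dec ℕ.anyUpTo? (λ i → (i + 1 ℕ.<? L) ×-dec (a ℕ.≟ 2 * i + 1) ×-dec (b ℕ.≟ 2 * i + 3)) L
     ⊎-dec (a ℕ.≟ 2 * L ∸ 1) ×-dec (b ℕ.≟ 1))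
    where
    P = (∃ λ i → i < L × a ≡ 2 * i × b ≡ 2 * i + 1) ⊎
        (∃ λ i → i < L × i + 1 < L × a ≡ 2 * i + 1 × b ≡ 2 * i + 3) ⊎
        (a ≡ 2 * L ∸ 1 × b ≡ 1)
    to : P → Edge L a b
    to (inj₁ (i , i<L , refl , refl))             = spoke i<L
    to (inj₂ (inj₁ (i , _ , i+1<L , refl , refl))) = rim i+1<L
    to (inj₂ (inj₂ (refl , refl)))                = close
    from : Edge L a b → P
    from (spoke i<L)     = inj₁ (_ , i<L , refl , refl)
    from (rim {i} i+1<L) = inj₂ (inj₁ (i , ℕ.≤-<-trans (ℕ.m≤m+n i 1) i+1<L , i+1<L , refl , refl))
    from close           = inj₂ (inj₂ (refl , refl))

  adj? : Decidable (Stacked L)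
  adj? u v = Dec.map′ (λ { (inj₁ e) → fwd e ; (inj₂ e) → bwd e }) (λ { (fwd e) → inj₁ e ; (bwd e) → inj₂ e })
    (edge? (toℕ u) (toℕ v) ⊎-dec edge? (toℕ v) (toℕ u))

  adj-sym : Symmetric (Stacked L)
  adj-sym = SymClosure.symmetric (Edge L)

  edge : ∀ {a b} {u v : Fin (2 * L)} → toℕ u ≡ a → toℕ v ≡ b → Edge L a b → Stacked L u v
  edge refl refl e = fwd e

  2i+1<2L : ∀ {i} → i < L → 2 * i + 1 < 2 * L
  2i+1<2L {i} i<L = subst (_≤ 2 * L) (eq i) (ℕ.*-monoʳ-≤ 2 i<L)
    where
    eq : ∀ i → 2 * suc i ≡ suc (2 * i + 1)
    eq = ℕ-Solver.solve-∀

  2i<2L : ∀ {i} → i < L → 2 * i < 2 * L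
  2i<2L {i} i<L = ℕ.≤-<-trans (ℕ.m≤m+n (2 * i) 1) (2i+1<2L i<L)

  -- Odd labels 2i + 1 are the rim vertices, indexed by i. This walk increases the index and avoids
  -- the closing edge.
  rim-walk : ∀ {i} m {u v : Fin (2 * L)} → i + m < L → toℕ u ≡ 2 * i + 1 → toℕ v ≡ 2 * (i + m) + 1 → Walk m u v
  rim-walk {i} zero {u} {v} _ u≡ v≡ =
    subst (Walk 0 u) (Fin.toℕ-injective (trans u≡ (trans (cong (λ j → 2 * j + 1) (sym (ℕ.+-identityʳ i))) (sym v≡)))) []
  rim-walk {i} (suc m) {u} {v} i+m<L u≡ v≡ =
    edge u≡ (trans (Fin.toℕ-fromℕ< _) (eq i)) (rim (ℕ.≤-<-trans (ℕ.+-monoʳ-≤ i (s≤s z≤n)) i+m<L))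
      ∷ rim-walk {suc i} m (subst (_< L) (ℕ.+-suc i m) i+m<L)
          (Fin.toℕ-fromℕ< (2i+1<2L (ℕ.≤-trans (s≤s (ℕ.m≤m+n (suc i) m)) (subst (_< L) (ℕ.+-suc i m) i+m<L))))
          (trans v≡ (cong (λ j → 2 * j + 1) (ℕ.+-suc i m)))
    where
    eq : ∀ i → 2 * suc i + 1 ≡ 2 * i + 3
    eq = ℕ-Solver.solve-∀

  to-rim : ∀ (u : Fin (2 * L)) → ∃ λ i → i < L × ∃ λ r → toℕ r ≡ 2 * i + 1 × ∃ λ n → n ≤ 1 × Walk n u r
  to-rim u with toℕ u % 2 | m%n<n (toℕ u) 2 | m≡m%n+[m/n]*n (toℕ u) 2
  ... | 1 | _ | e = i , i<L , u , u≡ , 0 , z≤n , []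
    where
    i = toℕ u / 2
    u≡ : toℕ u ≡ 2 * i + 1
    u≡ = trans e (trans (ℕ.+-comm 1 (i * 2)) (cong (_+ 1) (ℕ.*-comm i 2)))
    i<L : i < L
    i<L = ℕ.*-cancelˡ-< 2 i L (ℕ.≤-<-trans (ℕ.m≤m+n (2 * i) 1) (subst (_< 2 * L) u≡ (Fin.toℕ<n u)))
  ... | 0 | _ | e = i , i<L , fromℕ< (2i+1<2L i<L) , Fin.toℕ-fromℕ< _ , 1 , ℕ.≤-refl ,
                    edge u≡ (Fin.toℕ-fromℕ< _) (spoke i<L) ∷ []
    where
    i = toℕ u / 2
    u≡ : toℕ u ≡ 2 * i
    u≡ = trans e (ℕ.*-comm i 2)
    i<L : i < L
    i<L = ℕ.*-cancelˡ-< 2 i L (subst (_< 2 * L) u≡ (Fin.toℕ<n u))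
  ... | suc (suc _) | s≤s (s≤s ()) | _

-- The diameter for L = 2k + 3

module OddStackedComponent (k : ℕ) where

  L : ℕ
  L = 3 + (k + k)

  open StackedComponent L
  open Graph (Stacked L)
  open Walks {Adj = Stacked L}
  open FiniteWalks adj?

  2L∸1≡ : 2 * L ∸ 1 ≡ 2 * (2 + (k + k)) + 1
  2L∸1≡ = cong (_∸ 1) (eq k)
    where
    eq : ∀ k → 2 * (3 + (k + k)) ≡ suc (2 * (2 + (k + k)) + 1)
    eq = ℕ-Solver.solve-∀

  -- The two arcs between u and v have lengths m and L - m. If m ≥ k + 2, the second has length at
  -- most k + 1: t steps from v to the last rim vertex, the closing edge, and i steps from index 0
  -- to u.
  rim-distance : ∀ {i} m {u v : Fin (2 * L)} → i + m < L → toℕ u ≡ 2 * i + 1 → toℕ v ≡ 2 * (i + m) + 1 →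
                 ∃ λ n → n ≤ suc k × Walk n u v
  rim-distance {i} m {u} {v} i+m<L u≡ v≡ with m ℕ.≤? suc k
  ... | yes m≤1+k = m , m≤1+k , rim-walk m i+m<L u≡ v≡
  ... | no  m≰1+k = t + suc i , bound , reverse adj-sym (
        rim-walk {i + m} t (ℕ.≤-reflexive (cong suc i+m+t≡)) v≡ (trans (Fin.toℕ-fromℕ< last<) (cong (λ j → 2 * j + 1) (sym i+m+t≡)))
        ++ edge (Fin.toℕ-fromℕ< last<) (Fin.toℕ-fromℕ< first<) (subst (λ a → Edge L a 1) 2L∸1≡ close)
        ∷ rim-walk {0} i (ℕ.≤-<-trans (ℕ.m≤m+n i m) i+m<L) (Fin.toℕ-fromℕ< first<) u≡)
    where
    t = L ∸ suc (i + m)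
    i+m+t≡ : i + m + t ≡ 2 + (k + k)
    i+m+t≡ = ℕ.suc-injective (ℕ.m+[n∸m]≡n i+m<L)
    last< : 2 * (2 + (k + k)) + 1 < 2 * L
    last< = 2i+1<2L ℕ.≤-refl
    first< : 1 < 2 * L
    first< = s≤s (s≤s z≤n)
    bound : t + suc i ≤ suc k
    bound = ℕ.+-cancelʳ-≤ m (t + suc i) (suc k) (ℕ.≤-trans (ℕ.≤-reflexive (trans (eq₁ t i m) (cong suc i+m+t≡)))
      (ℕ.≤-trans (ℕ.≤-reflexive (eq₂ k)) (ℕ.+-monoʳ-≤ (suc k) (ℕ.≰⇒> m≰1+k))))
      where
      eq₁ : ∀ t i m → t + suc i + m ≡ suc (i + m + t)
      eq₁ = ℕ-Solver.solve-∀
      eq₂ : ∀ k → 3 + (k + k) ≡ suc k + suc (suc k)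
      eq₂ = ℕ-Solver.solve-∀

  rim-bound : ∀ {i j} {u v : Fin (2 * L)} → i < L → j < L → toℕ u ≡ 2 * i + 1 → toℕ v ≡ 2 * j + 1 →
              ∃ λ n → n ≤ suc k × Walk n u v
  rim-bound {i} {j} i<L j<L u≡ v≡ with ℕ.≤-total i j
  ... | inj₁ i≤j = rim-distance (j ∸ i) (subst (_< L) (sym (ℕ.m+[n∸m]≡n i≤j)) j<L) u≡
                     (trans v≡ (cong (λ z → 2 * z + 1) (sym (ℕ.m+[n∸m]≡n i≤j))))
  ... | inj₂ j≤i = let (n , n≤ , p) = rim-distance (i ∸ j) (subst (_< L) (sym (ℕ.m+[n∸m]≡n j≤i)) i<L) v≡
                                        (trans u≡ (cong (λ z → 2 * z + 1) (sym (ℕ.m+[n∸m]≡n j≤i)))) in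
    n , n≤ , reverse adj-sym p

  walk-bound : ∀ u v → ∃ λ n → n ≤ 3 + k × Walk n u v
  walk-bound u v =
    let (i , i<L , r , r≡ , a , a≤1 , p) = to-rim u
        (j , j<L , s , s≡ , b , b≤1 , q) = to-rim v
        (n , n≤ , w)                     = rim-bound i<L j<L r≡ s≡
    in a + (n + b) ,
       ℕ.≤-trans (ℕ.+-mono-≤ a≤1 (ℕ.+-mono-≤ n≤ b≤1)) (ℕ.≤-reflexive (cong suc (ℕ.+-comm (suc k) 1))) ,
       p ++ (w ++ reverse adj-sym q)

  -- The distance to the vertex 0.
  height : ℕ → ℕ
  height zero        = 0
  height a@(suc _) = (a / 2 ⊓ (L ∸ a / 2)) + (2 ∸ a % 2)

  -- The minimum is the distance along the rim to index 0, and the 2 counts the spokes at both ends.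
  -- At label 0 these would be the same spoke, hence `suc i` here and the separate clause in
  -- `height`.
  height-even : ∀ i → height (2 * suc i) ≡ (suc i ⊓ (L ∸ suc i)) + 2
  height-even i = cong₂ (λ q r → (q ⊓ (L ∸ q)) + (2 ∸ r))
    (trans (cong (_/ 2) (ℕ.*-comm 2 (suc i))) (m*n/n≡m (suc i) 2))
    (trans (cong (_% 2) (ℕ.*-comm 2 (suc i))) (m*n%n≡0 (suc i) 2))

  height-odd : ∀ i → height (2 * i + 1) ≡ (i ⊓ (L ∸ i)) + 1
  height-odd i = trans (cong height (eq i)) (cong₂ (λ q r → (q ⊓ (L ∸ q)) + (2 ∸ r))
    (trans (+-distrib-/-∣ʳ 1 {i * 2} {2} (n∣m*n i)) (m*n/n≡m i 2)) ([m+kn]%n≡m%n 1 i 2))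
    where
    eq : ∀ i → 2 * i + 1 ≡ suc (i * 2)
    eq = ℕ-Solver.solve-∀

  height-rim-step : ∀ i → i < L → let f = λ i → i ⊓ (L ∸ i) in f i ≤ suc (f (suc i)) × f (suc i) ≤ suc (f i)
  height-rim-step i i<L =
    ℕ.⊓-mono-≤ (ℕ.m≤n+m i 2) (ℕ.≤-reflexive L∸i≡) ,
    ℕ.⊓-mono-≤ ℕ.≤-refl (ℕ.≤-trans (ℕ.n≤1+n _) (ℕ.≤-trans (ℕ.≤-reflexive (sym L∸i≡)) (ℕ.n≤1+n _)))
    where
    L∸i≡ : L ∸ i ≡ suc (L ∸ suc i)
    L∸i≡ = ℕ.+-∸-assoc 1 i<L

  2i+3≡ : ∀ i → 2 * i + 3 ≡ 2 * suc i + 1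
  2i+3≡ = ℕ-Solver.solve-∀

  height-edge : ∀ {a b} → Edge L a b → height a ≤ suc (height b) × height b ≤ suc (height a)
  height-edge (spoke {zero} i<L)  = z≤n , ℕ.≤-refl
  height-edge (spoke {suc i} i<L)
    rewrite height-even i | height-odd (suc i) =
    ℕ.≤-reflexive (ℕ.+-suc f 1) , ℕ.≤-trans (ℕ.+-monoʳ-≤ f (s≤s z≤n)) (ℕ.n≤1+n _)
    where
    f = suc i ⊓ (L ∸ suc i)
  height-edge (rim {i} i+1<L)
    rewrite 2i+3≡ i | height-odd i | height-odd (suc i) =
    let (≤₁ , ≤₂) = height-rim-step i (ℕ.≤-<-trans (ℕ.m≤m+n i 1) i+1<L) in
    ℕ.+-monoˡ-≤ 1 ≤₁ , ℕ.+-monoˡ-≤ 1 ≤₂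
  -- The last rim vertex has index L - 1, so its height is at most 1 + 1, while `height 1` is 1.
  height-edge close = ℕ.≤-trans (ℕ.≤-reflexive (trans (cong height 2L∸1≡) (height-odd (2 + (k + k)))))
    (ℕ.+-monoˡ-≤ 1 (ℕ.≤-trans (ℕ.m⊓n≤n (2 + (k + k)) _) (ℕ.≤-reflexive (ℕ.m+n∸n≡m 1 (k + k))))) , s≤s z≤n

  height-adj : ∀ {u v : Fin (2 * L)} → Stacked L u v → height (toℕ u) ≤ suc (height (toℕ v))
  height-adj (fwd e) = proj₁ (height-edge e)
  height-adj (bwd e) = proj₂ (height-edge e)

  diametral : ∃₂ λ u v → IsDistance u v (3 + k)
  diametral =
    let (n , n≤ , p)       = walk-bound u v
        (d , dist , d≤n) = walk⇒distance p
    in u , v , subst (IsDistance u v) (ℕ.≤-antisym (ℕ.≤-trans d≤n n≤) (far (IsDistance.walk dist))) dist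
    where
    1+k<L : suc k < L
    1+k<L = s≤s (s≤s (ℕ.≤-trans (ℕ.m≤m+n k k) (ℕ.n≤1+n _)))
    -- Spoke tips over the rim indices k + 1 and 0, which are opposite: the arcs have lengths k + 1
    -- and k + 2.
    u v : Fin (2 * L)
    u = fromℕ< (2i<2L 1+k<L)
    v = fromℕ< {0} (s≤s z≤n)
    L∸1+k≡ : L ∸ suc k ≡ 2 + k
    L∸1+k≡ = trans (cong (_∸ k) (eq k)) (ℕ.m+n∸n≡m (2 + k) k)
      where
      eq : ∀ k → 2 + (k + k) ≡ 2 + k + k
      eq = ℕ-Solver.solve-∀
    height-u : height (toℕ u) ≡ 3 + k
    height-u = trans (cong height (Fin.toℕ-fromℕ< (2i<2L 1+k<L))) (trans (height-even k)
      (trans (cong (_+ 2) (ℕ.m≤n⇒m⊓n≡m (ℕ.≤-trans (ℕ.n≤1+n (suc k)) (ℕ.≤-reflexive (sym L∸1+k≡)))))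
        (cong suc (ℕ.+-comm k 2))))
    far : ∀ {n} → Walk n u v → 3 + k ≤ n
    far {n} p = subst₂ _≤_ height-u (ℕ.+-identityʳ n) (lipschitz⇒≤ (λ w → height (toℕ w)) height-adj p)

  isDiameter : IsDiameter (3 + k)
  isDiameter = record
    { attained = diametral
    ; bound    = λ u v → let (n , n≤ , p)     = walk-bound u v
                             (d , dist , d≤n) = walk⇒distance p
                         in d , dist , ℕ.≤-trans d≤n n≤
    }

-- The residues of p modulo 120

quarter-even : ∀ {p} r s → suc r ≡ s * 2 * 4 → 8 < r → p % 120 ≡ r →
               8 < p × ∃ λ n → suc p ≡ n * 2 * 4
quarter-even {p} r s 1+r≡ 8<r p%≡r =
  ℕ.<-≤-trans 8<r (ℕ.≤-trans (ℕ.m≤m+n r _) (ℕ.≤-reflexive (sym p≡))) ,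
  -- Here 15 = 120 / 8. The shape n * 2 * 4 exhibits (p + 1) / 4 as the even number n * 2.
  s + p / 120 * 15 , trans (cong suc p≡) (trans (cong (_+ p / 120 * 120) 1+r≡) (eq s (p / 120)))
  where
  p≡ : p ≡ r + p / 120 * 120
  p≡ = trans (m≡m%n+[m/n]*n p 120) (cong (_+ p / 120 * 120) p%≡r)
  eq : ∀ s q → s * 2 * 4 + q * 120 ≡ (s + q * 15) * 2 * 4
  eq = ℕ-Solver.solve-∀

ord₂-odd : ∀ {p L} n → Prime p → 8 < p → suc p ≡ n * 2 * 4 → IsOrd₂ p L → ∃ λ k → L ≡ 3 + (k + k)
ord₂-odd {p} n p-prime 8<p 1+p≡ (P , P-prime , 2∈P , ord) =
  order-above-2-odd p-prime 4c≡1+p (+ n , sym c≡) 8<p {P} P-prime 2∈P ord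
  where
  c≡ : + (suc p / 4) ≡ + n ℤ.* + 2
  c≡ = trans (cong +_ (trans (cong (_/ 4) 1+p≡) (m*n/n≡m (n * 2) 4))) (ℤ.pos-* n 2)
  4c≡1+p : + 4 ℤ.* + (suc p / 4) ≡ + suc p
  4c≡1+p = trans (sym (ℤ.pos-* 4 (suc p / 4)))
    (cong +_ (trans (ℕ.*-comm 4 (suc p / 4)) (m/n*n≡m (divides (n * 2) 1+p≡))))

theorem32 : ∀ (p L : ℕ) → Prime p → (p % 120 ≡ 71) ⊎ (p % 120 ≡ 119) →
    IsOrd₂ p L → ∃ λ d → Graph.IsDiameter (Stacked L) d × 2 * d ≡ L + 3
theorem32 p L p-prime p-mod ord = conclude
  (ord₂-odd (proj₁ (proj₂ residue)) p-prime (proj₁ residue) (proj₂ (proj₂ residue)) ord)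
  where
  residue : 8 < p × ∃ λ n → suc p ≡ n * 2 * 4
  -- Both residues are 7 modulo 8: 72 = 9 · 8 and 120 = 15 · 8.
  residue = [ quarter-even 71 9 refl (ℕ.m≤m+n 9 62) , quarter-even 119 15 refl (ℕ.m≤m+n 9 110) ]′ p-mod
  eq : ∀ k → 2 * (3 + k) ≡ 3 + (k + k) + 3
  eq = ℕ-Solver.solve-∀
  conclude : (∃ λ k → L ≡ 3 + (k + k)) → ∃ λ d → Graph.IsDiameter (Stacked L) d × 2 * d ≡ L + 3
  conclude (k , refl) = 3 + k , OddStackedComponent.isDiameter k , eq k
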